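{- Let $A$ be an invertible $n\times n$ matrix over a commutative ring of characteristic two, and put $B=A^{ -1}$, $\Delta=\det A$, $F=\Phi(A)$. Let $C$ be the $n\times n$ matrix with entries $C_{p,j}=A_{p,j}^2B_{j,p}$. Then $$\mathcal G(A)=\Delta\,BCB+(F+\Delta)B.$$ Once $F,B,\Delta$ are known, computing $\mathcal G(A)$ in this way costs two matrix multiplications and $O(n^2)$ additional operations.
   Context: For an $n\times n$ matrix $A$ over a commutative ring of characteristic two, $$\Phi(A)=\sum_{\pi\in S_n,\ \pi\text{ odd}}\ \prod_{i=1}^n A_{i,\pi(i)}$$ (sum over permutations that are odd in the usual sense; $\Phi(A)=0$ for orders $0$ and $1$), and $\mathcal G(A)$ is the $n\times n$ matrix with $\mathcal G(A)_{j,i}=\frac{\partial\Phi}{\partial A_{i,j}}(A)$, the formal partial derivatives of the polynomial $\Phi$ in the $n^2$ entries evaluated at $A$. A matrix over a commutative ring is invertible if it has an inverse over that ring. Operations are arithmetic operations in the ring. -}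

module Defs where

open import Algebra.Bundles using (RawSemiring; RawRing; CommutativeRing)
open import Algebra.Definitions using (Invertible)
import Algebra.Definitions.RawSemiring as SemiringDefs
open import Data.Bool.Base using (if_then_else_)
open import Data.Fin.Base using (Fin; zero; suc; _<_)
open import Data.Fin.Permutation using (Permutation′; id; insert; _⟨$⟩ʳ_)
open import Data.Fin.Properties using (_≟_; _<?_; all?)
open import Data.List.Base using (List; []; _∷_; _++_; allFin; cartesianProduct; cartesianProductWith; filter; foldr; length; map)
open import Data.Nat.Base as ℕ using (ℕ; zero; suc; parity)
import Data.Nat.Divisibility as ℕ
import Data.Nat.Properties as ℕ
open import Data.Parity.Base using (1ℙ)
import Data.Parity.Properties as Parity
open import Data.Product.Base using (_×_; _,_)
open import Data.Vec.Functional as Vector using (Vector)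
open import Function.Bundles using (_⇔_)
open import Level using (Level)
open import Relation.Binary.PropositionalEquality using (_≡_)
open import Relation.Nullary using (Dec; does; _×-dec_)

private
  variable
    a ℓ : Level
    X : Set a
    m n : ℕ

Matrix : Set a → ℕ → Set a
Matrix X n = Vector (Vector X n) n

------------------------------------------------------------------------
-- Permutations

-- Every permutation of Fin (suc n) is, for exactly one j and one
-- permutation π of Fin n, the one sending zero to j and otherwise
-- acting as π; hence each element of Sₙ is listed exactly once.
permutations : ∀ n → List (Permutation′ n)
permutations zero    = id ∷ []
permutations (suc n) =
  cartesianProductWith (insert zero) (allFin (suc n)) (permutations n)

Inversion : Permutation′ n → Fin n × Fin n → Set
Inversion π (i , j) = i < j × π ⟨$⟩ʳ j < π ⟨$⟩ʳ i

inversion? : (π : Permutation′ n) → ∀ ij → Dec (Inversion π ij)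
inversion? π (i , j) = (i <? j) ×-dec (π ⟨$⟩ʳ j <? π ⟨$⟩ʳ i)

inversions : Permutation′ n → ℕ
inversions {n} π =
  length (filter (inversion? π) (cartesianProduct (allFin n) (allFin n)))

Odd : Permutation′ n → Set
Odd π = parity (inversions π) ≡ 1ℙ

odd? : (π : Permutation′ n) → Dec (Odd π)
odd? π = parity (inversions π) Parity.≟ 1ℙ

------------------------------------------------------------------------
-- Sums, products and Φ over a (raw) semiring

module SemiringMatrices (S : RawSemiring a ℓ) where

  open RawSemiring S
  open SemiringDefs S using (sum; product)

  sumList : List Carrier → Carrier
  sumList = foldr _+_ 0#

  permutationProduct : Matrix Carrier n → Permutation′ n → Carrier
  permutationProduct A π = product λ i → A i (π ⟨$⟩ʳ i)

  Φ : Matrix Carrier n → Carrier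
  Φ {n} A =
    sumList (map (permutationProduct A) (filter odd? (permutations n)))

  infix  4 _≈ᴹ_
  infixl 6 _+ᴹ_
  infixl 7 _*ᴹ_ _·ᴹ_

  _≈ᴹ_ : Matrix Carrier n → Matrix Carrier n → Set _
  A ≈ᴹ B = ∀ i j → A i j ≈ B i j

  1ᴹ : Matrix Carrier n
  1ᴹ i j = if does (i ≟ j) then 1# else 0#

  _+ᴹ_ _*ᴹ_ : Matrix Carrier n → Matrix Carrier n → Matrix Carrier n
  (A +ᴹ B) i j = A i j + B i j
  (A *ᴹ B) i j = sum λ k → A i k * B k j

  _·ᴹ_ : Carrier → Matrix Carrier n → Matrix Carrier n
  (x ·ᴹ A) i j = x * A i j

------------------------------------------------------------------------
-- The polynomial semiring S[x₁₁, …, xₙₙ]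

module MatrixPolynomials (S : RawSemiring a ℓ) (n : ℕ) where

  open RawSemiring S
  open SemiringDefs S using (product; _^_) renaming (_×_ to _×ℕ_)
  open SemiringMatrices S using (sumList)

  Exponents : Set
  Exponents = Matrix ℕ n

  SameExponents : Exponents → Exponents → Set
  SameExponents e f = ∀ i j → e i j ≡ f i j

  sameExponents? : ∀ e f → Dec (SameExponents e f)
  sameExponents? e f = all? λ i → all? λ j → e i j ℕ.≟ f i j

  Term : Set _
  Term = Carrier × Exponents

  -- A polynomial is a formal sum of terms c ∏ xᵢⱼ ^ eᵢⱼ, in which the same
  -- exponents may occur repeatedly; equality compares coefficients.
  Polynomial : Set _
  Polynomial = List Term

  coefficient : Polynomial → Exponents → Carrier
  coefficient p e = sumList (map coeff p)
    where
    coeff : Term → Carrier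
    coeff (c , f) = if does (sameExponents? f e) then c else 0#

  unitExponents : Fin n → Fin n → Exponents
  unitExponents i j k l = if does ((i ≟ k) ×-dec (j ≟ l)) then 1 else 0

  mulTerm : Term → Term → Term
  mulTerm (c , e) (d , f) = c * d , λ i j → e i j ℕ.+ f i j

  polynomialSemiring : RawSemiring _ _
  polynomialSemiring = record
    { Carrier = Polynomial
    ; _≈_     = λ p q → ∀ e → coefficient p e ≈ coefficient q e
    ; _+_     = _++_
    ; _*_     = cartesianProductWith mulTerm
    ; 0#      = []
    ; 1#      = (1# , λ _ _ → 0) ∷ []
    }

  genericMatrix : Matrix Polynomial n
  genericMatrix i j = (1# , unitExponents i j) ∷ []

  -- ∂/∂xᵢⱼ (c xᵉ) = eᵢⱼ c xᵉ⁻¹ⁱʲ.  The truncated subtraction is harmless: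
  -- for eᵢⱼ = 0 the coefficient vanishes.
  ∂ : Fin n → Fin n → Polynomial → Polynomial
  ∂ i j = map λ (c , e) →
    e i j ×ℕ c , λ k l → e k l ℕ.∸ unitExponents i j k l

  eval : Matrix Carrier n → Polynomial → Carrier
  eval A p = sumList (map evalTerm p)
    where
    evalTerm : Term → Carrier
    evalTerm (c , e) = c * product λ i → product λ j → A i j ^ e i j

------------------------------------------------------------------------
-- Matrices over a commutative ring

module RingMatrices (R : CommutativeRing a ℓ) where

  open CommutativeRing R
  open RawRing rawRing using (rawSemiring)
  open SemiringDefs rawSemiring using () renaming (_×_ to _×ℕ_)
  open SemiringDefs rawSemiring public using (_^_)
  open SemiringMatrices rawSemiring public

  HasCharacteristic : ℕ → Set _
  HasCharacteristic p = ∀ k → k ×ℕ 1# ≈ 0# ⇔ p ℕ.∣ k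

  det : Matrix Carrier n → Carrier
  det {n} A = sumList (map signedProduct (permutations n))
    where
    signedProduct : Permutation′ n → Carrier
    signedProduct π =
      if does (odd? π) then - permutationProduct A π else permutationProduct A π

  Invertibleᴹ : Matrix Carrier n → Set _
  Invertibleᴹ = Invertible _≈ᴹ_ 1ᴹ _*ᴹ_

  Φ-polynomial : ∀ n → MatrixPolynomials.Polynomial rawSemiring n
  Φ-polynomial n = SemiringMatrices.Φ polynomialSemiring genericMatrix
    where open MatrixPolynomials rawSemiring n

  𝒢 : Matrix Carrier n → Matrix Carrier n
  𝒢 {n} A j i = eval A (∂ i j (Φ-polynomial n))
    where open MatrixPolynomials rawSemiring n

------------------------------------------------------------------------
-- Algebraic computations and their cost

data ArithmeticOp : Set where
  add sub mul : ArithmeticOp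

-- Computations whose scalars live in V and which may use one n × n matrix
-- multiplication as a single step.  An algorithm is a computation
-- polymorphic in V, so that it obtains new scalars only through the two
-- kinds of steps and cannot inspect the ones it has.
data Computation (V : Set a) (n : ℕ) (X : Set a) : Set a where
  return : X → Computation V n X
  arith  : ArithmeticOp → V → V → (V → Computation V n X) → Computation V n X
  matmul : Matrix V n → Matrix V n → (Matrix V n → Computation V n X) →
           Computation V n X

module _ {V : Set a} {n : ℕ} where

  infixl 1 _>>=_

  _>>=_ : {X Y : Set a} →
          Computation V n X → (X → Computation V n Y) → Computation V n Y
  return x       >>= f = f x
  arith op x y k >>= f = arith op x y λ z → k z >>= f
  matmul A B k   >>= f = matmul A B λ C → k C >>= f

  infixl 6 _⊞_
  infixl 7 _⊠_ _⊠ᴹ_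

  _⊞_ _⊠_ : V → V → Computation V n V
  x ⊞ y = arith add x y return
  x ⊠ y = arith mul x y return

  _⊠ᴹ_ : Matrix V n → Matrix V n → Computation V n (Matrix V n)
  A ⊠ᴹ B = matmul A B return

  sequence : {X : Set a} →
             Vector (Computation V n X) m → Computation V n (Vector X m)
  sequence {m = zero}  cs = return λ ()
  sequence {m = suc m} cs = do
    x  ← Vector.head cs
    xs ← sequence (Vector.tail cs)
    return (x Vector.∷ xs)

  forEntries : (Fin n → Fin n → Computation V n V) →
               Computation V n (Matrix V n)
  forEntries f = sequence λ i → sequence λ j → f i j

  -- Evaluates Δ BCB + (F + Δ) B with C p j = (A p j)² (B j p).
  gradientAlgorithm : (A B : Matrix V n) (F Δ : V) →
                      Computation V n (Matrix V n)
  gradientAlgorithm A B F Δ = do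
    C   ← forEntries λ p j → do
            s ← A p j ⊠ A p j
            s ⊠ B j p
    BC  ← B ⊠ᴹ C
    BCB ← BC ⊠ᴹ B
    F+Δ ← F ⊞ Δ
    forEntries λ i j → do
      x ← Δ ⊠ BCB i j
      y ← F+Δ ⊠ B i j
      x ⊞ y

module Execution (R : RawRing a ℓ) {n : ℕ} where

  open RawRing R
  open SemiringMatrices rawSemiring using (_*ᴹ_)

  applyOp : ArithmeticOp → Carrier → Carrier → Carrier
  applyOp add x y = x + y
  applyOp sub x y = x + - y
  applyOp mul x y = x * y

  result : {X : Set a} → Computation Carrier n X → X
  result (return x)       = x
  result (arith op x y k) = result (k (applyOp op x y))
  result (matmul A B k)   = result (k (A *ᴹ B))

  arithmeticOps : {X : Set a} → Computation Carrier n X → ℕ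
  arithmeticOps (return x)       = 0
  arithmeticOps (arith op x y k) = suc (arithmeticOps (k (applyOp op x y)))
  arithmeticOps (matmul A B k)   = arithmeticOps (k (A *ᴹ B))

  matrixMultiplications : {X : Set a} → Computation Carrier n X → ℕ
  matrixMultiplications (return x)       = 0
  matrixMultiplications (arith op x y k) =
    matrixMultiplications (k (applyOp op x y))
  matrixMultiplications (matmul A B k)   =
    suc (matrixMultiplications (k (A *ᴹ B)))

{-# OPTIONS --safe #-}

-- The entry 𝒢(A)ⱼᵢ is Φ of A with row i replaced by the unit row eⱼ.  Since
-- eⱼ = Σₚ Bⱼₚ Aₚ and Φ is linear in each row, it suffices to know Φ of A with
-- row i replaced by row p.  For p = i this is F.  For p ≠ i rows i and p both
-- equal v = Aₚ, and expanding them gives Σ v_q v_r φ(q,r), where φ(q,r) puts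
-- e_q and e_r into rows i and p.  Exchanging two rows exchanges even and odd
-- permutations, so φ(q,r) + φ(r,q) is a determinant, and Jacobi's formula
-- evaluates it as Δ (B_qi B_rp + B_ri B_qp).  Hence φ(q,r) + Δ B_qi B_rp is
-- symmetric in q and r, and in characteristic two the sum of a symmetric
-- matrix is its trace.  As φ(q,q) = 0 and Σ_q v_q B_qi = (AB)ₚᵢ = 0, what
-- remains is Δ Σ_q v_q² B_qp B_qi = Δ (CB)ₚᵢ.

module Submission where

open import Defs
open import Algebra.Bundles using (CommutativeMonoid; CommutativeRing; RawRing)
import Algebra.Definitions.RawSemiring as SemiringDefs
import Algebra.Properties.CommutativeMonoid.Sum as Sum
open import Data.Bool.Base using (Bool; true; false; if_then_else_; _∧_)
open import Data.Fin.Base using (Fin; zero; suc; punchIn; punchOut; toℕ)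
open import Data.Fin.Permutation using (Permutation′; insert; _⟨$⟩ʳ_)
open import Data.Fin.Properties
  using (_≟_; _<?_; suc-injective; punchInᵢ≢i; punchOut-cong; punchOut-punchIn)
open import Data.List.Base
  using (List; []; _∷_; _++_; cartesianProduct; cartesianProductWith; filter; length; map; tabulate)
open import Data.List.Properties using (filter-++; length-++; map-++; map-tabulate; map-∘)
open import Data.Nat.Base as ℕ using (ℕ; zero; suc; parity; _≤_)
import Data.Nat.Divisibility as ℕ using (∣-refl)
import Data.Nat.Properties as ℕ
open import Data.Nat.Solver using (module +-*-Solver)
open import Data.Parity.Base as Parity using (Parity; 0ℙ; 1ℙ; _⁻¹)
import Data.Parity.Properties as Parity
open import Data.Product.Base using (_×_; _,_; ∃-syntax; proj₁)
open import Data.Vec.Functional using (Vector; updateAt) renaming (_∷_ to _∷ᵛ_)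
open import Data.Vec.Functional.Properties
  using (updateAt-updates; updateAt-minimal; updateAt-id-local)
open import Function.Base using (_∘_; id)
open import Function.Bundles using (Equivalence; Injection)
open import Function.Properties.Inverse using (↔⇒↣)
open import Level using (Level)
open import Relation.Binary.PropositionalEquality as ≡ using (_≡_; _≢_)
open import Relation.Nullary using (does; yes; no; contradiction)
open import Relation.Unary using (Decidable)

private
  variable
    a ℓ p : Level
    X Y : Set a
    m n : ℕ

-- Finite sums with at most one nontrivial term.

module _ (M : CommutativeMonoid a ℓ) where

  open CommutativeMonoid M
  open Sum M

  sum-≈ε : {f : Vector Carrier n} → (∀ i → f i ≈ ε) → sum f ≈ ε
  sum-≈ε {n} f≈ε = trans (sum-cong-≋ f≈ε) (sum-replicate-zero n)

  -- The general monoid covers three uses: sums in the ring, products in the ring and sums of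
  -- natural exponents.
  sum-support : (k : Fin n) {f : Vector Carrier n} →
                (∀ i → i ≢ k → f i ≈ ε) → sum f ≈ f k
  sum-support {suc n} k {f} f≈ε = trans (sum-remove {i = k} f)
    (trans (∙-congˡ (sum-≈ε λ i → f≈ε (punchIn k i) (punchInᵢ≢i k i)))
           (identityʳ _))

-- Counting the inversions of a permutation.

open Sum ℕ.+-0-commutativeMonoid using ()
  renaming (sum to sumℕ; sum-cong-≗ to sumℕ-cong; sum-permute to sumℕ-permute)

indicator : Bool → ℕ
indicator b = if b then 1 else 0

length-filter-tabulate : {P : X → Set p} (P? : Decidable P) (f : Fin n → X) →
  length (filter P? (tabulate f)) ≡ sumℕ λ i → indicator (does (P? (f i)))
length-filter-tabulate {n = zero}  P? f = ≡.refl
length-filter-tabulate {n = suc n} P? f with does (P? (f zero))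
... | true  = ≡.cong suc (length-filter-tabulate P? (f ∘ suc))
... | false = length-filter-tabulate P? (f ∘ suc)

length-filter-cartesianProduct :
  {P : X × Y → Set p} (P? : Decidable P) (f : Fin m → X) (g : Fin n → Y) →
  length (filter P? (cartesianProduct (tabulate f) (tabulate g))) ≡
  sumℕ λ i → sumℕ λ j → indicator (does (P? (f i , g j)))
length-filter-cartesianProduct {m = zero}  P? f g = ≡.refl
length-filter-cartesianProduct {m = suc m} P? f g = begin
  length (filter P? (xs ++ ys))                  ≡⟨ ≡.cong length (filter-++ P? xs ys) ⟩
  length (filter P? xs ++ filter P? ys)          ≡⟨ length-++ (filter P? xs) ⟩
  length (filter P? xs) ℕ.+ length (filter P? ys) ≡⟨ ≡.cong₂ ℕ._+_
    (≡.trans (≡.cong (length ∘ filter P?) (map-tabulate g (f zero ,_)))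
             (length-filter-tabulate P? (λ j → f zero , g j)))
    (length-filter-cartesianProduct P? (f ∘ suc) g) ⟩
  _ ∎
  where
  open ≡.≡-Reasoning
  xs = map (f zero ,_) (tabulate g)
  ys = cartesianProduct (tabulate (f ∘ suc)) (tabulate g)

does-punchIn-<? : (j : Fin (suc n)) (k l : Fin n) →
  does (punchIn j k <? punchIn j l) ≡ does (k <? l)
does-punchIn-<? zero    k       l       = ≡.refl
does-punchIn-<? (suc j) zero    zero    = ≡.refl
does-punchIn-<? (suc j) zero    (suc l) = ≡.refl
does-punchIn-<? (suc j) (suc k) zero    = ≡.refl
does-punchIn-<? (suc j) (suc k) (suc l) = does-punchIn-<? j k l

-- `punchIn j` runs through every index except `j`, so it meets each index below `j` once.
count-punchIn-< : (j : Fin (suc n)) →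
  sumℕ (λ k → indicator (does (punchIn j k <? j))) ≡ toℕ j
count-punchIn-< {n}     zero    = sum-≈ε ℕ.+-0-commutativeMonoid {n} λ _ → ≡.refl
count-punchIn-< {suc n} (suc j) = ≡.cong suc (count-punchIn-< j)

-- Position zero forms an inversion with each position whose value is below `j`. The remaining
-- inversions are those of `π`, since `punchIn j` preserves the order.
inversions-insert : (j : Fin (suc n)) (π : Permutation′ n) →
  inversions (insert zero j π) ≡ toℕ j ℕ.+ inversions π
inversions-insert {n} j π = begin
  inversions (insert zero j π)
    ≡⟨ length-filter-cartesianProduct (inversion? (insert zero j π)) id id ⟩
  -- Pairs with second position zero have disappeared by computation, as no position precedes zero.
  sumℕ (λ k → indicator (below-j (π ⟨$⟩ʳ k))) ℕ.+
  sumℕ (λ k → sumℕ λ l → indicator (does (k <? l) ∧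
    does (punchIn j (π ⟨$⟩ʳ l) <? punchIn j (π ⟨$⟩ʳ k))))
    ≡⟨ ≡.cong₂ ℕ._+_
         -- The number of values below `j` does not depend on the order in which `π` takes them.
         (≡.trans (≡.sym (sumℕ-permute (indicator ∘ below-j) π)) (count-punchIn-< j))
         (sumℕ-cong λ k → sumℕ-cong λ l → ≡.cong (λ b → indicator (does (k <? l) ∧ b))
           (does-punchIn-<? j (π ⟨$⟩ʳ l) (π ⟨$⟩ʳ k))) ⟩
  toℕ j ℕ.+ sumℕ (λ k → sumℕ λ l → indicator (does (inversion? π (k , l))))
    ≡⟨ ≡.cong (toℕ j ℕ.+_) (length-filter-cartesianProduct (inversion? π) id id) ⟨
  toℕ j ℕ.+ inversions π ∎
  where
  open ≡.≡-Reasoning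
  below-j : Fin n → Bool
  below-j k = does (punchIn j k <? j)

-- Removing two columns in either order.

parity-suc : ∀ n → parity (suc n) ≡ parity n ⁻¹
parity-suc n = ≡.sym (≡.trans (≡.cong _⁻¹ (≡.sym (Parity.suc-homo-⁻¹ n)))
                              (Parity.⁻¹-involutive (parity (suc n))))

parity-suc-+ : ∀ m n → parity (suc m) Parity.+ parity (suc n) ≡ parity m Parity.+ parity n
parity-suc-+ m n rewrite parity-suc m | parity-suc n with parity m | parity n
... | 0ℙ | 0ℙ = ≡.refl
... | 0ℙ | 1ℙ = ≡.refl
... | 1ℙ | 0ℙ = ≡.refl
... | 1ℙ | 1ℙ = ≡.refl

-- Removing the smaller index first lowers the other by one, while removing the larger first leaves
-- the other unchanged. The two index sums therefore differ by one.
parity-punchOut : {j l : Fin (suc n)} (j≢l : j ≢ l) (l≢j : l ≢ j) →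
  parity (toℕ (punchOut j≢l)) Parity.+ parity (toℕ j) ≡
  (parity (toℕ (punchOut l≢j)) Parity.+ parity (toℕ l)) ⁻¹
parity-punchOut {j = zero} {zero} j≢l _ = contradiction ≡.refl j≢l
parity-punchOut {suc n} {zero} {suc l} _ _ =
  ≡.trans (Parity.+-identityʳ (parity (toℕ l))) (≡.sym (Parity.suc-homo-⁻¹ (toℕ l)))
parity-punchOut {suc n} {suc j} {zero} _ _ =
  ≡.trans (parity-suc (toℕ j)) (≡.cong _⁻¹ (≡.sym (Parity.+-identityʳ (parity (toℕ j)))))
parity-punchOut {suc n} {suc j} {suc l} j≢l l≢j = begin
  parity (suc (toℕ (punchOut j≢l′))) Parity.+ parity (suc (toℕ j))
    ≡⟨ parity-suc-+ (toℕ (punchOut j≢l′)) (toℕ j) ⟩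
  parity (toℕ (punchOut j≢l′)) Parity.+ parity (toℕ j)
    ≡⟨ parity-punchOut j≢l′ l≢j′ ⟩
  (parity (toℕ (punchOut l≢j′)) Parity.+ parity (toℕ l)) ⁻¹
    ≡⟨ ≡.cong _⁻¹ (parity-suc-+ (toℕ (punchOut l≢j′)) (toℕ l)) ⟨
  (parity (suc (toℕ (punchOut l≢j′))) Parity.+ parity (suc (toℕ l))) ⁻¹ ∎
  where
  open ≡.≡-Reasoning
  j≢l′ = j≢l ∘ ≡.cong suc
  l≢j′ = l≢j ∘ ≡.cong suc

-- Both sides list the indices other than `j` and `l` in increasing order.
punchIn-punchOut-comm : {j l : Fin (suc (suc n))} (j≢l : j ≢ l) (l≢j : l ≢ j) (k : Fin n) →
  punchIn j (punchIn (punchOut j≢l) k) ≡ punchIn l (punchIn (punchOut l≢j) k)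
punchIn-punchOut-comm {j = zero}  {zero}  j≢l _ _ = contradiction ≡.refl j≢l
punchIn-punchOut-comm {j = zero}  {suc l} _ _ _ = ≡.refl
punchIn-punchOut-comm {j = suc j} {zero}  _ _ _ = ≡.refl
punchIn-punchOut-comm {j = suc j} {suc l} _ _ zero = ≡.refl
punchIn-punchOut-comm {j = suc j} {suc l} j≢l l≢j (suc k) =
  ≡.cong suc (punchIn-punchOut-comm (j≢l ∘ ≡.cong suc) (l≢j ∘ ≡.cong suc) k)

module ParityExpansion (R : CommutativeRing a ℓ) where

  open CommutativeRing R hiding (zero)
  open RingMatrices R
  open RawRing rawRing using (rawSemiring)
  open SemiringDefs rawSemiring using (sum; product)
  open import Algebra.Properties.Semiring.Sum semiring
    using (sum-cong-≋; sum-remove; ∑-comm; ∑-distrib-+; *-distribˡ-sum; *-distribʳ-sum)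
  open Sum *-commutativeMonoid using ()
    renaming (sum-cong-≋ to product-cong; sum-remove to product-remove)
  open import Algebra.Properties.CommutativeSemigroup *-commutativeSemigroup
    using (x∙yz≈y∙xz)
  open import Relation.Binary.Reasoning.Setoid setoid

  -- Sums over lists and index sets in the ring.

  sumList-cong : {f g : X → Carrier} → (∀ x → f x ≈ g x) →
                 ∀ xs → sumList (map f xs) ≈ sumList (map g xs)
  sumList-cong f≈g []       = refl
  sumList-cong f≈g (x ∷ xs) = +-cong (f≈g x) (sumList-cong f≈g xs)

  sumList-++ : ∀ xs ys → sumList (xs ++ ys) ≈ sumList xs + sumList ys
  sumList-++ []       ys = sym (+-identityˡ _)
  sumList-++ (x ∷ xs) ys = trans (+-congˡ (sumList-++ xs ys)) (sym (+-assoc _ _ _))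

  sumList-+ : (f g : X → Carrier) → ∀ xs →
    sumList (map (λ x → f x + g x) xs) ≈ sumList (map f xs) + sumList (map g xs)
  sumList-+ f g []       = sym (+-identityˡ _)
  sumList-+ f g (x ∷ xs) = trans (+-congˡ (sumList-+ f g xs)) (interchange _ _ _ _)
    where open import Algebra.Properties.CommutativeSemigroup +-commutativeSemigroup using (interchange)

  *-distribˡ-sumList : ∀ c (f : X → Carrier) xs →
    c * sumList (map f xs) ≈ sumList (map (λ x → c * f x) xs)
  *-distribˡ-sumList c f []       = zeroʳ c
  *-distribˡ-sumList c f (x ∷ xs) =
    trans (distribˡ c _ _) (+-congˡ (*-distribˡ-sumList c f xs))

  sumList-∑-comm : (f : X → Vector Carrier n) → ∀ xs →
    sumList (map (sum ∘ f) xs) ≈ sum λ k → sumList (map (λ x → f x k) xs)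
  sumList-∑-comm {n = n} f []       = sym (sum-≈ε +-commutativeMonoid {n} λ _ → refl)
  sumList-∑-comm {n = n} f (x ∷ xs) = trans (+-congˡ (sumList-∑-comm f xs))
    (sym (∑-distrib-+ {n} (f x) λ k → sumList (map (λ x → f x k) xs)))

  [_] : Bool → Carrier
  [ b ] = if b then 1# else 0#

  sumList-filter : {P : X → Set p} (P? : Decidable P) (f : X → Carrier) → ∀ xs →
    sumList (map f (filter P? xs)) ≈ sumList (map (λ x → [ does (P? x) ] * f x) xs)
  sumList-filter P? f []       = refl
  sumList-filter P? f (x ∷ xs) with does (P? x)
  ... | true  = +-cong (sym (*-identityˡ _)) (sumList-filter P? f xs)
  ... | false = trans (sumList-filter P? f xs)
                  (sym (trans (+-congʳ (zeroˡ _)) (+-identityˡ _)))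

  -- The arbitrary `tabulate g` in place of `allFin` lets the induction pass to `g ∘ suc`.
  sumList-cartesianProductWith :
    (F : Y → Carrier) (f : Fin m → X → Y) (g : Fin n → Fin m) (xs : List X) →
    sumList (map F (cartesianProductWith f (tabulate g) xs)) ≈
    sum λ j → sumList (map (λ x → F (f (g j) x)) xs)
  sumList-cartesianProductWith {n = zero}  F f g xs = refl
  sumList-cartesianProductWith {n = suc n} F f g xs = begin
    sumList (map F (map (f (g zero)) xs ++ rest))
      ≡⟨ ≡.cong sumList (map-++ F (map (f (g zero)) xs) rest) ⟩
    sumList (map F (map (f (g zero)) xs) ++ map F rest)
      ≈⟨ sumList-++ (map F (map (f (g zero)) xs)) _ ⟩
    sumList (map F (map (f (g zero)) xs)) + sumList (map F rest)
      ≈⟨ +-cong (reflexive (≡.cong sumList (≡.sym (map-∘ xs))))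
                (sumList-cartesianProductWith F f (g ∘ suc) xs) ⟩
    _ ∎
    where rest = cartesianProductWith f (tabulate (g ∘ suc)) xs

  ∑-delta : (k : Fin n) (f : Vector Carrier n) → sum (λ i → 1ᴹ k i * f i) ≈ f k
  ∑-delta k f = trans (sum-support +-commutativeMonoid k off) diag
    where
    off : ∀ i → i ≢ k → 1ᴹ k i * f i ≈ 0#
    off i i≢k with k ≟ i
    ... | yes k≡i = contradiction (≡.sym k≡i) i≢k
    ... | no  _   = zeroˡ _
    diag : 1ᴹ k k * f k ≈ f k
    diag with k ≟ k
    ... | yes _   = *-identityˡ _
    ... | no  k≢k = contradiction ≡.refl k≢k

  product-zero : (i : Fin n) {f : Vector Carrier n} → f i ≈ 0# → product f ≈ 0#
  product-zero {suc n} i {f} fi≈0 =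
    trans (product-remove {i = i} f) (trans (*-congʳ fi≈0) (zeroˡ _))

  -- Even and odd permutation sums and their Laplace expansions.

  weight : Parity → Permutation′ n → Carrier
  weight b π = [ does (parity (inversions π) Parity.≟ b) ]

  -- A weight of zero or one replaces filtering, so that even and odd sums run over the same list
  -- and an expansion only has to shift the parity.
  paritySum : Parity → Matrix Carrier n → Carrier
  paritySum {n} b A = sumList (map (λ π → weight b π * permutationProduct A π) (permutations n))

  Φ≈paritySum : (A : Matrix Carrier n) → Φ A ≈ paritySum 1ℙ A
  Φ≈paritySum {n} A = sumList-filter odd? (permutationProduct A) (permutations n)

  paritySum-cong : ∀ b {A A′ : Matrix Carrier n} → A ≈ᴹ A′ → paritySum b A ≈ paritySum b A′
  paritySum-cong {n} b A≈A′ = sumList-cong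
    (λ π → *-congˡ (product-cong λ i → A≈A′ i (π ⟨$⟩ʳ i))) (permutations n)

  minor : Matrix Carrier (suc n) → Fin (suc n) → Matrix Carrier n
  minor A j k l = A (suc k) (punchIn j l)

  -- By `inversions-insert` the value `j` contributes `toℕ j` inversions, and modulo two this
  -- contribution can be moved to the prescribed parity.
  weight-insert : ∀ b j (π : Permutation′ n) →
    weight b (insert zero j π) ≡ weight (parity (toℕ j) Parity.+ b) π
  weight-insert b j π
    rewrite inversions-insert j π
          | Parity.+-homo-+ (toℕ j) (inversions π)
    with parity (toℕ j) | parity (inversions π) | b
  ... | 0ℙ | _  | _  = ≡.refl
  ... | 1ℙ | 0ℙ | 0ℙ = ≡.refl
  ... | 1ℙ | 0ℙ | 1ℙ = ≡.refl
  ... | 1ℙ | 1ℙ | 0ℙ = ≡.refl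
  ... | 1ℙ | 1ℙ | 1ℙ = ≡.refl

  -- The permutations are grouped by the image `j` of zero. What is the sign of a term in the
  -- expansion of a determinant becomes a shift of the parity.
  laplace : ∀ b (A : Matrix Carrier (suc n)) →
    paritySum b A ≈ sum λ j → A zero j * paritySum (parity (toℕ j) Parity.+ b) (minor A j)
  laplace {n} b A = trans
    (sumList-cartesianProductWith _ (insert zero) (λ j → j) (permutations n))
    (sum-cong-≋ λ j → trans
      (sumList-cong (λ π → trans
        (*-congʳ (reflexive (weight-insert b j π)))
        (x∙yz≈y∙xz (weight (parity (toℕ j) Parity.+ b) π) (A zero j)
                   (permutationProduct (minor A j) π)))
        (permutations n))
      (sym (*-distribˡ-sumList (A zero j) _ (permutations n))))

  -- The coefficient of A₀ⱼ A₁ₗ in paritySum b A, where M consists of the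
  -- remaining rows.
  coeff₂ : Parity → (Fin n → Fin (suc (suc n)) → Carrier) → (j l : Fin (suc (suc n))) → Carrier
  coeff₂ b M j l with j ≟ l
  -- No permutation uses a column twice; the value zero lets both columns range over all indices
  -- independently.
  ... | yes _   = 0#
  ... | no  j≢l = paritySum (parity (toℕ (punchOut j≢l)) Parity.+ (parity (toℕ j) Parity.+ b))
                    (λ r c → M r (punchIn j (punchIn (punchOut j≢l) c)))

  -- Removing the two columns in the other order leaves the same submatrix but, by
  -- `parity-punchOut`, reverses the parity.
  coeff₂-comm : ∀ b (M : Fin n → Fin (suc (suc n)) → Carrier) j l →
                coeff₂ b M j l ≈ coeff₂ (b ⁻¹) M l j
  coeff₂-comm b M j l with j ≟ l | l ≟ j
  ... | yes _   | yes _   = refl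
  ... | yes j≡l | no  l≢j = contradiction (≡.sym j≡l) l≢j
  ... | no  j≢l | yes l≡j = contradiction (≡.sym l≡j) j≢l
  ... | no  j≢l | no  l≢j = trans
    (reflexive (≡.cong (λ c → paritySum c (λ r k → M r (punchIn j (punchIn (punchOut j≢l) k)))) parities))
    (paritySum-cong _ λ r c → reflexive (≡.cong (M r) (punchIn-punchOut-comm j≢l l≢j c)))
    where
    ⁻¹-+ : ∀ x y → x ⁻¹ Parity.+ y ≡ x Parity.+ y ⁻¹
    ⁻¹-+ 0ℙ y = ≡.refl
    ⁻¹-+ 1ℙ y = ≡.sym (Parity.⁻¹-involutive y)
    parities :
      parity (toℕ (punchOut j≢l)) Parity.+ (parity (toℕ j) Parity.+ b) ≡
      parity (toℕ (punchOut l≢j)) Parity.+ (parity (toℕ l) Parity.+ b ⁻¹)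
    parities = ≡.trans (≡.sym (Parity.+-assoc (parity (toℕ (punchOut j≢l))) (parity (toℕ j)) b))
      (≡.trans (≡.cong (Parity._+ b) (parity-punchOut j≢l l≢j))
      (≡.trans (⁻¹-+ (parity (toℕ (punchOut l≢j)) Parity.+ parity (toℕ l)) b)
               (Parity.+-assoc (parity (toℕ (punchOut l≢j))) (parity (toℕ l)) (b ⁻¹))))

  coeff₂-diagonal : ∀ b (M : Fin n → Fin (suc (suc n)) → Carrier) j → coeff₂ b M j j ≈ 0#
  coeff₂-diagonal b M j with j ≟ j
  ... | yes _   = refl
  ... | no  j≢j = contradiction ≡.refl j≢j

  coeff₂-punchIn : ∀ b (M : Fin n → Fin (suc (suc n)) → Carrier) j k →
    coeff₂ b M j (punchIn j k) ≈
    paritySum (parity (toℕ k) Parity.+ (parity (toℕ j) Parity.+ b))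
      (λ r c → M r (punchIn j (punchIn k c)))
  coeff₂-punchIn b M j k with j ≟ punchIn j k
  ... | yes j≡  = contradiction (≡.sym j≡) (punchInᵢ≢i j k)
  ... | no  j≢  = reflexive (≡.cong
    (λ k → paritySum (parity (toℕ k) Parity.+ (parity (toℕ j) Parity.+ b))
      (λ r c → M r (punchIn j (punchIn k c))))
    (≡.trans (punchOut-cong j ≡.refl) (punchOut-punchIn j)))

  -- The second expansion is reindexed by the original columns, with a zero term at `l = j`. Its
  -- range then no longer depends on `j`, so the two sums can be interchanged.
  laplace₂ : ∀ b (A : Matrix Carrier (suc (suc n))) →
    paritySum b A ≈ sum λ j → sum λ l →
      A zero j * (A (suc zero) l * coeff₂ b (λ r → A (suc (suc r))) j l)
  laplace₂ b A = trans (laplace b A) (sum-cong-≋ λ j → trans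
    (*-congˡ (begin
      paritySum (parity (toℕ j) Parity.+ b) (minor A j)
        ≈⟨ laplace _ (minor A j) ⟩
      sum (λ k → A (suc zero) (punchIn j k) *
        paritySum (parity (toℕ k) Parity.+ (parity (toℕ j) Parity.+ b)) (minor (minor A j) k))
        ≈⟨ sum-cong-≋ (λ k → *-congˡ {A (suc zero) (punchIn j k)} (coeff₂-punchIn b M j k)) ⟨
      sum (λ k → t j (punchIn j k))
        ≈⟨ +-identityˡ _ ⟨
      0# + sum (λ k → t j (punchIn j k))
        ≈⟨ +-congʳ (trans (*-congˡ (coeff₂-diagonal b M j)) (zeroʳ _)) ⟨
      t j j + sum (λ k → t j (punchIn j k))
        ≈⟨ sum-remove {i = j} (t j) ⟨
      sum (t j) ∎))
    (*-distribˡ-sum (A zero j) (t j)))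
    where
    M = λ r → A (suc (suc r))
    t = λ j l → A (suc zero) l * coeff₂ b M j l

  -- In the expansion along both rows, exchanging the rows amounts to exchanging the two summation
  -- indices, which reverses the parity in `coeff₂`.
  paritySum-swap-01 : ∀ b {A A′ : Matrix Carrier (suc (suc n))} →
    (∀ j → A′ zero j ≈ A (suc zero) j) →
    (∀ j → A′ (suc zero) j ≈ A zero j) →
    (∀ r j → A′ (suc (suc r)) j ≈ A (suc (suc r)) j) →
    paritySum b A′ ≈ paritySum (b ⁻¹) A
  paritySum-swap-01 b {A} {A′} A′₀≈A₁ A′₁≈A₀ A′≈A = begin
    paritySum b A′
      ≈⟨ paritySum-cong b A′≈A″ ⟩
    paritySum b A″
      ≈⟨ laplace₂ b A″ ⟩
    sum (λ j → sum λ l → A (suc zero) j * (A zero l * coeff₂ b M j l))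
      ≈⟨ sum-cong-≋ (λ j → sum-cong-≋ λ l → trans (x∙yz≈y∙xz (A (suc zero) j) (A zero l) (coeff₂ b M j l))
           (*-congˡ (*-congˡ (coeff₂-comm b M j l)))) ⟩
    sum (λ j → sum λ l → A zero l * (A (suc zero) j * coeff₂ (b ⁻¹) M l j))
      ≈⟨ ∑-comm (λ j l → A zero l * (A (suc zero) j * coeff₂ (b ⁻¹) M l j)) ⟩
    sum (λ l → sum λ j → A zero l * (A (suc zero) j * coeff₂ (b ⁻¹) M l j))
      ≈⟨ laplace₂ (b ⁻¹) A ⟨
    paritySum (b ⁻¹) A ∎
    where
    M = λ r → A (suc (suc r))
    A″ : Matrix Carrier _
    A″ zero          = A (suc zero)
    A″ (suc zero)    = A zero
    A″ (suc (suc r)) = A (suc (suc r))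
    A′≈A″ : A′ ≈ᴹ A″
    A′≈A″ zero          = A′₀≈A₁
    A′≈A″ (suc zero)    = A′₁≈A₀
    A′≈A″ (suc (suc r)) = A′≈A r

  -- Exchange of two arbitrary rows.

  FlipsParity : Fin n → Fin n → Set _
  FlipsParity {n} i p = ∀ b {A A′ : Matrix Carrier n} →
    (∀ j → A′ i j ≈ A p j) → (∀ j → A′ p j ≈ A i j) →
    (∀ r → r ≢ i → r ≢ p → ∀ j → A′ r j ≈ A r j) →
    paritySum b A′ ≈ paritySum (b ⁻¹) A

  flipsParity-sym : {i p : Fin n} → FlipsParity i p → FlipsParity p i
  flipsParity-sym flips b A′i≈Ap A′p≈Ai A′≈A =
    flips b A′p≈Ai A′i≈Ap (λ r r≢p r≢i → A′≈A r r≢i r≢p)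

  -- Expansion along row zero, which stays in place, reduces the exchange to the minors. Their
  -- parities vary with the column, which is why `FlipsParity` quantifies over `b`.
  flipsParity-suc : {i p : Fin n} → FlipsParity i p → FlipsParity (suc i) (suc p)
  flipsParity-suc flips b {A} {A′} A′i≈Ap A′p≈Ai A′≈A = begin
    paritySum b A′
      ≈⟨ laplace b A′ ⟩
    sum (λ j → A′ zero j * paritySum (parity (toℕ j) Parity.+ b) (minor A′ j))
      ≈⟨ sum-cong-≋ (λ j → *-cong (A′≈A zero (λ ()) (λ ()) j)
           (trans (flips (parity (toℕ j) Parity.+ b)
                     (λ l → A′i≈Ap (punchIn j l)) (λ l → A′p≈Ai (punchIn j l))
                     (λ r r≢i r≢p l →
                       A′≈A (suc r) (r≢i ∘ suc-injective) (r≢p ∘ suc-injective) (punchIn j l)))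
                  (reflexive (≡.cong (λ c → paritySum c (minor A j)) (+-⁻¹ (parity (toℕ j)) b))))) ⟩
    sum (λ j → A zero j * paritySum (parity (toℕ j) Parity.+ b ⁻¹) (minor A j))
      ≈⟨ laplace (b ⁻¹) A ⟨
    paritySum (b ⁻¹) A ∎
    where
    +-⁻¹ : ∀ x y → (x Parity.+ y) ⁻¹ ≡ x Parity.+ y ⁻¹
    +-⁻¹ 0ℙ y = ≡.refl
    +-⁻¹ 1ℙ y = ≡.refl

  -- The transposition (0 p) is (0 1) (1 p) (0 1).
  flipsParity-zero : (p : Fin n) → FlipsParity zero (suc p)
  flipsParity-zero zero b {A} {A′} A′₀≈A₁ A′₁≈A₀ A′≈A =
    paritySum-swap-01 b {A} {A′} A′₀≈A₁ A′₁≈A₀ (λ r → A′≈A (suc (suc r)) (λ ()) (λ ()))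
  flipsParity-zero (suc p) b {A} {A′} A′₀≈Aₚ A′ₚ≈A₀ A′≈A = begin
    paritySum b A′
      ≈⟨ paritySum-swap-01 b {swap A′} {A′} (λ _ → refl) (λ _ → refl) (λ _ _ → refl) ⟩
    paritySum (b ⁻¹) (swap A′)
      ≈⟨ flipsParity-suc (flipsParity-zero p) (b ⁻¹) {swap A} {swap A′} A′₀≈Aₚ A′ₚ≈A₀ off ⟩
    paritySum (b ⁻¹ ⁻¹) (swap A)
      ≈⟨ paritySum-swap-01 (b ⁻¹ ⁻¹) {A} {swap A} (λ _ → refl) (λ _ → refl) (λ _ _ → refl) ⟩
    paritySum (b ⁻¹ ⁻¹ ⁻¹) A
      ≡⟨ ≡.cong (λ c → paritySum c A) (Parity.⁻¹-involutive (b ⁻¹)) ⟩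
    paritySum (b ⁻¹) A ∎
    where
    swap : Matrix Carrier (suc (suc n)) → Matrix Carrier (suc (suc n))
    swap A zero          = A (suc zero)
    swap A (suc zero)    = A zero
    swap A (suc (suc r)) = A (suc (suc r))
    off : ∀ r → r ≢ suc zero → r ≢ suc (suc p) → ∀ j → swap A′ r j ≈ swap A r j
    off zero          _     _   = A′≈A (suc zero) (λ ()) (λ ())
    off (suc zero)    1≢1   _   = contradiction ≡.refl 1≢1
    off (suc (suc r)) _     r≢p = A′≈A (suc (suc r)) (λ ()) r≢p

  paritySum-swap : (i p : Fin n) → i ≢ p → FlipsParity i p
  paritySum-swap zero    zero    0≢0 = contradiction ≡.refl 0≢0
  paritySum-swap zero    (suc p) _   = flipsParity-zero p
  paritySum-swap (suc i) zero    _   = flipsParity-sym (flipsParity-zero i)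
  paritySum-swap (suc i) (suc p) i≢p =
    flipsParity-suc (paritySum-swap i p (i≢p ∘ ≡.cong suc))

  -- Row replacement and multilinearity.

  infixl 8 _[_]≔_

  _[_]≔_ : Matrix Carrier n → Fin n → Vector Carrier n → Matrix Carrier n
  A [ i ]≔ v = updateAt A i λ _ → v

  []≔-updated : (A : Matrix Carrier n) (i : Fin n) {v : Vector Carrier n} →
                ∀ j → (A [ i ]≔ v) i j ≈ v j
  []≔-updated A i j = reflexive (≡.cong-app (updateAt-updates i A) j)

  []≔-minimal : (A : Matrix Carrier n) {i k : Fin n} {v : Vector Carrier n} →
                k ≢ i → ∀ j → (A [ i ]≔ v) k j ≈ A k j
  []≔-minimal A {i} {k} k≢i j = reflexive (≡.cong-app (updateAt-minimal k i A k≢i) j)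

  []≔-self : (A : Matrix Carrier n) (i : Fin n) → A [ i ]≔ A i ≈ᴹ A
  []≔-self A i k j = reflexive (≡.cong-app (updateAt-id-local i A ≡.refl k) j)

  []≔-cong : (A : Matrix Carrier n) (i : Fin n) {v w : Vector Carrier n} →
             (∀ j → v j ≈ w j) → A [ i ]≔ v ≈ᴹ A [ i ]≔ w
  []≔-cong A i v≈w k j with k ≟ i
  ... | yes ≡.refl = trans ([]≔-updated A i j) (trans (v≈w j) (sym ([]≔-updated A i j)))
  ... | no  k≢i    = trans ([]≔-minimal A k≢i j) (sym ([]≔-minimal A k≢i j))

  permutationProduct-row : (A : Matrix Carrier (suc n)) (i : Fin (suc n)) (v : Vector Carrier (suc n))
    (π : Permutation′ (suc n)) →
    permutationProduct (A [ i ]≔ v) π ≈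
    v (π ⟨$⟩ʳ i) * product λ k → A (punchIn i k) (π ⟨$⟩ʳ punchIn i k)
  permutationProduct-row A i v π = trans
    (product-remove {i = i} λ k → (A [ i ]≔ v) k (π ⟨$⟩ʳ k))
    (*-cong ([]≔-updated A i (π ⟨$⟩ʳ i))
            (product-cong λ k → []≔-minimal A (punchInᵢ≢i i k) (π ⟨$⟩ʳ punchIn i k)))

  -- Each permutation product has exactly one factor from row `i`, so linearity already holds
  -- permutation by permutation.
  paritySum-linear : ∀ b (A : Matrix Carrier n) i (c : Vector Carrier m)
    (V : Fin m → Vector Carrier n) →
    paritySum b (A [ i ]≔ λ j → sum λ k → c k * V k j) ≈
    sum λ k → c k * paritySum b (A [ i ]≔ V k)
  paritySum-linear {n = suc n} {m = m} b A i c V = begin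
    paritySum b (A [ i ]≔ λ j → sum λ k → c k * V k j)
      ≈⟨ sumList-cong linear (permutations (suc n)) ⟩
    sumList (map (λ π → sum λ k → c k * term k π) (permutations (suc n)))
      ≈⟨ sumList-∑-comm (λ π k → c k * term k π) (permutations (suc n)) ⟩
    sum (λ k → sumList (map (λ π → c k * term k π) (permutations (suc n))))
      ≈⟨ sum-cong-≋ (λ k → *-distribˡ-sumList (c k) (term k) (permutations (suc n))) ⟨
    sum (λ k → c k * paritySum b (A [ i ]≔ V k)) ∎
    where
    term : Fin m → Permutation′ (suc n) → Carrier
    term k π = weight b π * permutationProduct (A [ i ]≔ V k) π
    linear : ∀ π → weight b π * permutationProduct (A [ i ]≔ λ j → sum λ k → c k * V k j) π ≈
                   sum λ k → c k * term k π
    linear π = begin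
      w * permutationProduct (A [ i ]≔ λ j → sum λ k → c k * V k j) π
        ≈⟨ *-congˡ (permutationProduct-row A i _ π) ⟩
      w * (sum (λ k → c k * V k πi) * rest)
        ≈⟨ *-congˡ (*-distribʳ-sum rest λ k → c k * V k πi) ⟩
      w * sum (λ k → c k * V k πi * rest)
        ≈⟨ *-distribˡ-sum w (λ k → c k * V k πi * rest) ⟩
      sum (λ k → w * (c k * V k πi * rest))
        ≈⟨ sum-cong-≋ (λ k → trans (*-congˡ (*-assoc (c k) (V k πi) rest))
             (trans (x∙yz≈y∙xz w (c k) (V k πi * rest))
                    (*-congˡ (*-congˡ (sym (permutationProduct-row A i (V k) π)))))) ⟩
      sum (λ k → c k * (w * permutationProduct (A [ i ]≔ V k) π)) ∎
      where
      w    = weight b π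
      πi   = π ⟨$⟩ʳ i
      rest = product λ k → A (punchIn i k) (π ⟨$⟩ʳ punchIn i k)

  1ᴹ-comm : (i j : Fin n) → 1ᴹ i j ≈ 1ᴹ j i
  1ᴹ-comm i j with i ≟ j | j ≟ i
  ... | yes _   | yes _   = refl
  ... | no  _   | no  _   = refl
  ... | yes i≡j | no  j≢i = contradiction (≡.sym i≡j) j≢i
  ... | no  i≢j | yes j≡i = contradiction (≡.sym j≡i) i≢j

  1ᴹ-off : {i j : Fin n} → i ≢ j → 1ᴹ i j ≈ 0#
  1ᴹ-off {i = i} {j} i≢j with i ≟ j
  ... | yes i≡j = contradiction i≡j i≢j
  ... | no  _   = refl

  1ᴹ-diagonal : (i : Fin n) → 1ᴹ i i ≈ 1#
  1ᴹ-diagonal i with i ≟ i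
  ... | yes _   = refl
  ... | no  i≢i = contradiction ≡.refl i≢i

  -- Linearity, applied to `v` written in the standard basis.
  paritySum-expand : ∀ b (A : Matrix Carrier n) i (v : Vector Carrier n) →
    paritySum b (A [ i ]≔ v) ≈ sum λ q → v q * paritySum b (A [ i ]≔ 1ᴹ q)
  paritySum-expand b A i v = trans
    (paritySum-cong b ([]≔-cong A i λ j → sym (trans
      (sum-cong-≋ λ q → trans (*-comm (v q) (1ᴹ q j)) (*-congʳ (1ᴹ-comm q j)))
      (∑-delta j v))))
    (paritySum-linear b A i v 1ᴹ)

  -- A product without a zero factor would force `π` to send both `i` and `p` to `q`, against
  -- injectivity.
  paritySum-same-column : ∀ b (A : Matrix Carrier n) {i p : Fin n} q → i ≢ p →
    paritySum b (A [ i ]≔ 1ᴹ q [ p ]≔ 1ᴹ q) ≈ 0#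
  paritySum-same-column {n} b A {i} {p} q i≢p = trans
    (sumList-cong (λ π → trans (*-congˡ (vanishes π)) (zeroʳ _)) (permutations n))
    (sumList-0 (permutations n))
    where
    sumList-0 : (xs : List X) → sumList (map (λ _ → 0#) xs) ≈ 0#
    sumList-0 []       = refl
    sumList-0 (x ∷ xs) = trans (+-identityˡ _) (sumList-0 xs)
    vanishes : ∀ π → permutationProduct (A [ i ]≔ 1ᴹ q [ p ]≔ 1ᴹ q) π ≈ 0#
    vanishes π with q ≟ (π ⟨$⟩ʳ i)
    ... | no q≢πi = product-zero i (trans ([]≔-minimal (A [ i ]≔ 1ᴹ q) i≢p _)
                                   (trans ([]≔-updated A i _) (1ᴹ-off q≢πi)))
    ... | yes q≡πi = product-zero p (trans ([]≔-updated (A [ i ]≔ 1ᴹ q) p _)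
      (1ᴹ-off λ q≡πp → i≢p (Injection.injective (↔⇒↣ π) (≡.trans (≡.sym q≡πi) q≡πp))))

  -- The partial derivatives of Φ

  module _ {n : ℕ} where

    open MatrixPolynomials rawSemiring n
    open SemiringDefs polynomialSemiring using () renaming (product to productᴾ)
    open SemiringMatrices polynomialSemiring using ()
      renaming (sumList to sumListᴾ; permutationProduct to permutationProductᴾ)

    eval-++ : (A : Matrix Carrier n) (p q : Polynomial) → eval A (p ++ q) ≈ eval A p + eval A q
    eval-++ A []      q = sym (+-identityˡ _)
    eval-++ A (t ∷ p) q = trans (+-congˡ (eval-++ A p q)) (sym (+-assoc _ _ _))

    eval-∂-sumList : (A : Matrix Carrier n) (i j : Fin n) (f : X → Polynomial) → ∀ xs →
      eval A (∂ i j (sumListᴾ (map f xs))) ≈ sumList (map (λ x → eval A (∂ i j (f x))) xs)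
    eval-∂-sumList A i j f []       = refl
    eval-∂-sumList A i j f (x ∷ xs) = begin
      eval A (∂ i j (f x ++ sumListᴾ (map f xs)))
        ≡⟨ ≡.cong (eval A) (map-++ _ (f x) _) ⟩
      eval A (∂ i j (f x) ++ ∂ i j (sumListᴾ (map f xs)))
        ≈⟨ eval-++ A (∂ i j (f x)) _ ⟩
      eval A (∂ i j (f x)) + eval A (∂ i j (sumListᴾ (map f xs)))
        ≈⟨ +-congˡ (eval-∂-sumList A i j f xs) ⟩
      eval A (∂ i j (f x)) + sumList (map (λ x → eval A (∂ i j (f x))) xs) ∎

    -- A product of one-term lists is again a one-term list. The equality is propositional and hence
    -- passes under `∂` and `eval`.
    product-monomials : (c : Vector Carrier m) (e : Vector Exponents m) →
      productᴾ (λ k → (c k , e k) ∷ []) ≡ (product c , λ i j → sumℕ λ k → e k i j) ∷ []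
    product-monomials {zero}  c e = ≡.refl
    product-monomials {suc m} c e
      rewrite product-monomials (c ∘ suc) (e ∘ suc) = ≡.refl

    permutationExponents : Permutation′ n → Exponents
    permutationExponents π i j = sumℕ λ k → unitExponents k (π ⟨$⟩ʳ k) i j

    unitExponents-row : ∀ i j l → unitExponents i j i l ≡ indicator (does (j ≟ l))
    unitExponents-row i j l with i ≟ i
    ... | yes _   = ≡.refl
    ... | no  i≢i = contradiction ≡.refl i≢i

    unitExponents-off : ∀ {i k} j l → i ≢ k → unitExponents i j k l ≡ 0
    unitExponents-off {i} {k} j l i≢k with i ≟ k
    ... | yes i≡k = contradiction i≡k i≢k
    ... | no  _   = ≡.refl

    -- Among the factors of the monomial of `π`, only the one from row `i` is a variable of row `i`.
    permutationExponents-indicator : ∀ π i j →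
      permutationExponents π i j ≡ indicator (does ((π ⟨$⟩ʳ i) ≟ j))
    permutationExponents-indicator π i j = ≡.trans
      (sum-support ℕ.+-0-commutativeMonoid i {λ k → unitExponents k (π ⟨$⟩ʳ k) i j}
        (λ k k≢i → unitExponents-off (π ⟨$⟩ʳ k) j k≢i))
      (unitExponents-row i (π ⟨$⟩ʳ i) j)

    product-ones : {f : Vector Carrier m} → (∀ i → f i ≈ 1#) → product f ≈ 1#
    product-ones = sum-≈ε *-commutativeMonoid

    product-^-indicator : (x : Vector Carrier m) (k : Fin m) →
      product (λ l → x l ^ indicator (does (k ≟ l))) ≈ x k
    product-^-indicator x k = trans
      (sum-support *-commutativeMonoid k {λ l → x l ^ indicator (does (k ≟ l))} off) diag
      where
      off : ∀ l → l ≢ k → x l ^ indicator (does (k ≟ l)) ≈ 1#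
      off l l≢k with k ≟ l
      ... | yes k≡l = contradiction (≡.sym k≡l) l≢k
      ... | no  _   = refl
      diag : x k ^ indicator (does (k ≟ k)) ≈ x k
      diag with k ≟ k
      ... | yes _   = *-identityʳ _
      ... | no  k≢k = contradiction ≡.refl k≢k

    -- The monomial of `π` has degree one in row `i`. Differentiation deletes its factor there if
    -- `π` sends `i` to `j` and kills the monomial otherwise; substituting a unit row does the same.
    ∂-permutationProduct : (A : Matrix Carrier n) (i j : Fin n) (π : Permutation′ n) →
      eval A (∂ i j (permutationProductᴾ genericMatrix π)) ≈
      permutationProduct (A [ i ]≔ 1ᴹ j) π
    ∂-permutationProduct A i j π = begin
      eval A (∂ i j (permutationProductᴾ genericMatrix π))
        ≡⟨ ≡.cong (eval A ∘ ∂ i j) (product-monomials (λ _ → 1#) (λ k → unitExponents k (π ⟨$⟩ʳ k))) ⟩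
      e i j ×ℕ product {n} (λ _ → 1#) * rows + 0#
        ≈⟨ +-identityʳ _ ⟩
      e i j ×ℕ product {n} (λ _ → 1#) * rows
        ≡⟨ ≡.cong (λ t → t ×ℕ product {n} (λ _ → 1#) * rows) (permutationExponents-indicator π i j) ⟩
      indicator (does ((π ⟨$⟩ʳ i) ≟ j)) ×ℕ product {n} (λ _ → 1#) * rows
        ≈⟨ cases ⟩
      permutationProduct (A [ i ]≔ 1ᴹ j) π ∎
      where
      open SemiringDefs rawSemiring using () renaming (_×_ to _×ℕ_)
      e = permutationExponents π
      row : Fin n → Carrier
      row k = product λ l → A k l ^ (e k l ℕ.∸ unitExponents i j k l)
      rows = product row

      row-off : ∀ k → k ≢ i → row k ≈ A k (π ⟨$⟩ʳ k)
      row-off k k≢i = trans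
        (product-cong λ l → reflexive (≡.cong (A k l ^_) (≡.cong₂ ℕ._∸_
          (permutationExponents-indicator π k l) (unitExponents-off j l (k≢i ∘ ≡.sym)))))
        (product-^-indicator (A k) (π ⟨$⟩ʳ k))

      -- In this case the exponents in row `i` are exactly those that `∂ i j` subtracts.
      row-i : π ⟨$⟩ʳ i ≡ j → row i ≈ 1#
      row-i πi≡j = product-ones λ l → reflexive (≡.cong (A i l ^_) (≡.trans
        (≡.cong₂ ℕ._∸_
          (≡.trans (permutationExponents-indicator π i l) (≡.cong (λ k → indicator (does (k ≟ l))) πi≡j))
          (unitExponents-row i j l))
        (ℕ.n∸n≡0 (indicator (does (j ≟ l))))))

      cases : indicator (does ((π ⟨$⟩ʳ i) ≟ j)) ×ℕ product {n} (λ _ → 1#) * rows ≈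
              permutationProduct (A [ i ]≔ 1ᴹ j) π
      cases with (π ⟨$⟩ʳ i) ≟ j
      ... | no πi≢j = trans (zeroˡ rows) (sym (product-zero i
              (trans ([]≔-updated A i _) (1ᴹ-off (πi≢j ∘ ≡.sym)))))
      ... | yes πi≡j = trans
              (*-congʳ (trans (+-identityʳ _) (product-ones {n} λ _ → refl)))
              (trans (*-identityˡ rows) (product-cong row≈))
        where
        row≈ : ∀ k → row k ≈ (A [ i ]≔ 1ᴹ j) k (π ⟨$⟩ʳ k)
        row≈ k with k ≟ i
        ... | no  k≢i    = trans (row-off k k≢i) (sym ([]≔-minimal A k≢i _))
        ... | yes ≡.refl = trans (row-i πi≡j) (sym (trans ([]≔-updated A i _)
              (trans (reflexive (≡.cong (1ᴹ j) πi≡j)) (1ᴹ-diagonal j))))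

  -- Differentiation and evaluation are additive, so the comparison is made for each odd permutation
  -- separately.
  𝒢≈Φ : (A : Matrix Carrier n) → ∀ i j → 𝒢 A j i ≈ Φ (A [ i ]≔ 1ᴹ j)
  𝒢≈Φ {n} A i j = trans
    (eval-∂-sumList A i j (permutationProductᴾ genericMatrix) (filter odd? (permutations n)))
    (sumList-cong (∂-permutationProduct A i j) (filter odd? (permutations n)))
    where
    open MatrixPolynomials rawSemiring n
    open SemiringMatrices polynomialSemiring using ()
      renaming (permutationProduct to permutationProductᴾ)

  -- Matrix multiplication and the permanent.

  *ᴹ-assoc : (A B C : Matrix Carrier n) → A *ᴹ B *ᴹ C ≈ᴹ A *ᴹ (B *ᴹ C)
  *ᴹ-assoc A B C i l = begin
    sum (λ k → sum (λ j → A i j * B j k) * C k l)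
      ≈⟨ sum-cong-≋ (λ k → *-distribʳ-sum (C k l) (λ j → A i j * B j k)) ⟩
    sum (λ k → sum λ j → A i j * B j k * C k l)
      ≈⟨ ∑-comm (λ k j → A i j * B j k * C k l) ⟩
    sum (λ j → sum λ k → A i j * B j k * C k l)
      ≈⟨ sum-cong-≋ (λ j → sum-cong-≋ λ k → *-assoc (A i j) (B j k) (C k l)) ⟩
    sum (λ j → sum λ k → A i j * (B j k * C k l))
      ≈⟨ sum-cong-≋ (λ j → *-distribˡ-sum (A i j) (λ k → B j k * C k l)) ⟨
    sum (λ j → A i j * sum λ k → B j k * C k l) ∎

  *ᴹ-cong : {A A′ B B′ : Matrix Carrier n} → A ≈ᴹ A′ → B ≈ᴹ B′ → A *ᴹ B ≈ᴹ A′ *ᴹ B′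
  *ᴹ-cong A≈A′ B≈B′ i j = sum-cong-≋ λ k → *-cong (A≈A′ i k) (B≈B′ k j)

  -- Split by parity so that facts about `paritySum` carry over; in characteristic two it is the
  -- determinant.
  permanent : Matrix Carrier n → Carrier
  permanent A = paritySum 0ℙ A + paritySum 1ℙ A

  permanent-cong : {A A′ : Matrix Carrier n} → A ≈ᴹ A′ → permanent A ≈ permanent A′
  permanent-cong A≈A′ = +-cong (paritySum-cong 0ℙ A≈A′) (paritySum-cong 1ℙ A≈A′)

  permanent-linear : (A : Matrix Carrier n) (i : Fin n) (c : Vector Carrier m)
    (V : Fin m → Vector Carrier n) →
    permanent (A [ i ]≔ λ j → sum λ k → c k * V k j) ≈
    sum λ k → c k * permanent (A [ i ]≔ V k)
  permanent-linear A i c V = begin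
    permanent (A [ i ]≔ λ j → sum λ k → c k * V k j)
      ≈⟨ +-cong (paritySum-linear 0ℙ A i c V) (paritySum-linear 1ℙ A i c V) ⟩
    sum (λ k → c k * paritySum 0ℙ (A [ i ]≔ V k)) + sum (λ k → c k * paritySum 1ℙ (A [ i ]≔ V k))
      ≈⟨ ∑-distrib-+ (λ k → c k * paritySum 0ℙ (A [ i ]≔ V k)) (λ k → c k * paritySum 1ℙ (A [ i ]≔ V k)) ⟨
    sum (λ k → c k * paritySum 0ℙ (A [ i ]≔ V k) + c k * paritySum 1ℙ (A [ i ]≔ V k))
      ≈⟨ sum-cong-≋ (λ k → distribˡ (c k) (paritySum 0ℙ (A [ i ]≔ V k)) (paritySum 1ℙ (A [ i ]≔ V k))) ⟨
    sum (λ k → c k * permanent (A [ i ]≔ V k)) ∎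

  -- A row exchange interchanges the even and the odd summand.
  permanent-swap : {i p : Fin n} → i ≢ p → {A A′ : Matrix Carrier n} →
    (∀ j → A′ i j ≈ A p j) → (∀ j → A′ p j ≈ A i j) →
    (∀ r → r ≢ i → r ≢ p → ∀ j → A′ r j ≈ A r j) → permanent A′ ≈ permanent A
  permanent-swap {i = i} {p} i≢p {A} {A′} A′i≈Ap A′p≈Ai A′≈A = trans
    (+-cong (paritySum-swap i p i≢p 0ℙ {A} {A′} A′i≈Ap A′p≈Ai A′≈A)
            (paritySum-swap i p i≢p 1ℙ {A} {A′} A′i≈Ap A′p≈Ai A′≈A))
    (+-comm _ _)

-- Sums and determinants in characteristic two.

module CharacteristicTwo (R : CommutativeRing a ℓ)
  (char2 : RingMatrices.HasCharacteristic R 2) where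

  open CommutativeRing R hiding (zero)
  open RingMatrices R
  open ParityExpansion R
  open RawRing rawRing using (rawSemiring)
  open SemiringDefs rawSemiring using (sum)
  open import Algebra.Properties.Semiring.Sum semiring
    using (sum-cong-≋; ∑-distrib-+; *-distribˡ-sum; *-distribʳ-sum)
  open import Algebra.Properties.Group +-group using (inverseˡ-unique)
  open import Algebra.Solver.Ring.NaturalCoefficients.Default commutativeSemiring
    using (solve; _:=_; _:+_; _:*_; con)
  open import Relation.Binary.Reasoning.Setoid setoid

  1+1≈0 : 1# + 1# ≈ 0#
  1+1≈0 = trans (+-congˡ (sym (+-identityʳ 1#))) (Equivalence.from (char2 2) ℕ.∣-refl)

  x+x≈0 : ∀ x → x + x ≈ 0#
  x+x≈0 x = begin
    x + x              ≈⟨ +-cong (*-identityˡ x) (*-identityˡ x) ⟨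
    1# * x + 1# * x    ≈⟨ distribʳ x 1# 1# ⟨
    (1# + 1#) * x      ≈⟨ *-congʳ 1+1≈0 ⟩
    0# * x             ≈⟨ zeroˡ x ⟩
    0#                 ∎

  -x≈x : ∀ x → - x ≈ x
  -x≈x x = sym (inverseˡ-unique x x (x+x≈0 x))

  x+[x+y]≈y : ∀ x y → x + (x + y) ≈ y
  x+[x+y]≈y x y = trans (sym (+-assoc x x y)) (trans (+-congʳ (x+x≈0 x)) (+-identityˡ y))

  -- Mirror entries off the diagonal cancel in pairs; the induction cancels the rest of the first
  -- row against the rest of the first column.
  ∑-symmetric : (f : Fin n → Fin n → Carrier) → (∀ i j → f i j ≈ f j i) →
                sum (λ i → sum λ j → f i j) ≈ sum λ i → f i i
  ∑-symmetric {zero}  f f-sym = refl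
  ∑-symmetric {suc n} f f-sym = begin
    f zero zero + r + sum (λ i → f (suc i) zero + sum λ j → f (suc i) (suc j))
      ≈⟨ +-congˡ (∑-distrib-+ (λ i → f (suc i) zero) λ i → sum λ j → f (suc i) (suc j)) ⟩
    f zero zero + r + (sum (λ i → f (suc i) zero) + s)
      ≈⟨ +-congˡ (+-congʳ (sum-cong-≋ λ i → f-sym (suc i) zero)) ⟩
    f zero zero + r + (r + s)
      ≈⟨ trans (+-assoc (f zero zero) r (r + s)) (+-congˡ (x+[x+y]≈y r s)) ⟩
    f zero zero + s
      ≈⟨ +-congˡ (∑-symmetric (λ i j → f (suc i) (suc j)) λ i j → f-sym (suc i) (suc j)) ⟩
    f zero zero + sum (λ i → f (suc i) (suc i)) ∎
    where
    r = sum λ j → f zero (suc j)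
    s = sum λ i → sum λ j → f (suc i) (suc j)

  det≈permanent : (A : Matrix Carrier n) → det A ≈ permanent A
  det≈permanent {n} A = trans
    (sumList-cong split (permutations n))
    (sumList-+ (λ π → weight 0ℙ π * permutationProduct A π)
               (λ π → weight 1ℙ π * permutationProduct A π) (permutations n))
    where
    split : ∀ π →
      (if does (odd? π) then - permutationProduct A π else permutationProduct A π) ≈
      weight 0ℙ π * permutationProduct A π + weight 1ℙ π * permutationProduct A π
    split π with parity (inversions π)
    ... | 0ℙ = sym (trans (+-cong (*-identityˡ _) (zeroˡ _)) (+-identityʳ _))
    ... | 1ℙ = trans (-x≈x _) (sym (trans (+-cong (zeroˡ _) (*-identityˡ _)) (+-identityˡ _)))

  -- Exchanging the equal rows changes nothing, so the even and the odd sum agree and their total is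
  -- twice one of them.
  permanent-equal-rows : (A : Matrix Carrier n) {i p : Fin n} → i ≢ p →
    (∀ j → A i j ≈ A p j) → permanent A ≈ 0#
  permanent-equal-rows A {i} {p} i≢p Ai≈Ap = trans
    (+-congʳ (paritySum-swap i p i≢p 0ℙ {A} {A} Ai≈Ap (λ j → sym (Ai≈Ap j)) (λ _ _ _ _ → refl)))
    (x+x≈0 _)

  -- Cramer's rule and Jacobi's formula.

  module _ {n : ℕ} (A B : Matrix Carrier n) (BA≈1 : B *ᴹ A ≈ᴹ 1ᴹ) where

    Δ = permanent A

    -- Row `q` of `B *ᴹ A` writes the unit row as a combination of the rows of `A`.
    permanent-unitRow : (M : Matrix Carrier n) (i q : Fin n) →
      permanent (M [ i ]≔ 1ᴹ q) ≈ sum λ k → B q k * permanent (M [ i ]≔ A k)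
    permanent-unitRow M i q = trans
      (permanent-cong ([]≔-cong M i λ j → sym (BA≈1 q j)))
      (permanent-linear M i (B q) A)

    -- After the unit row is expanded in the rows of `A`, every term except `k = i` contains a
    -- repeated row.
    cramer : ∀ i q → permanent (A [ i ]≔ 1ᴹ q) ≈ Δ * B q i
    cramer i q = begin
      permanent (A [ i ]≔ 1ᴹ q)
        ≈⟨ permanent-unitRow A i q ⟩
      sum (λ k → B q k * permanent (A [ i ]≔ A k))
        ≈⟨ sum-cong-≋ (λ k → trans (*-congˡ (replaced k))
             (solve 3 (λ b e d → b :* (e :* d) := e :* (d :* b)) refl (B q k) (1ᴹ i k) Δ)) ⟩
      sum (λ k → 1ᴹ i k * (Δ * B q k))
        ≈⟨ ∑-delta i (λ k → Δ * B q k) ⟩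
      Δ * B q i ∎
      where
      replaced : ∀ k → permanent (A [ i ]≔ A k) ≈ 1ᴹ i k * Δ
      replaced k with i ≟ k
      ... | yes ≡.refl = trans (permanent-cong ([]≔-self A i)) (sym (*-identityˡ Δ))
      ... | no  i≢k    = trans
        (permanent-equal-rows (A [ i ]≔ A k) i≢k λ j →
          trans ([]≔-updated A i j) (sym ([]≔-minimal A (i≢k ∘ ≡.sym) j)))
        (sym (zeroˡ Δ))

    -- The left-hand side is a minor of order n ∸ 2, evaluated by Jacobi's formula.
    jacobi : ∀ {i p} → i ≢ p → ∀ q r →
      permanent (A [ i ]≔ 1ᴹ q [ p ]≔ 1ᴹ r) ≈ Δ * (B q i * B r p) + Δ * (B r i * B q p)
    jacobi {i} {p} i≢p q r = begin
      permanent (M [ p ]≔ 1ᴹ r)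
        ≈⟨ permanent-unitRow M p r ⟩
      sum (λ k → B r k * permanent (M [ p ]≔ A k))
        ≈⟨ sum-cong-≋ (λ k → trans (*-congˡ (replaced k))
             (solve 6 (λ b e f d x y → b :* (e :* (d :* x) :+ f :* (d :* y)) :=
                                       e :* (d :* (x :* b)) :+ f :* (d :* (b :* y)))
                    refl (B r k) (1ᴹ p k) (1ᴹ i k) Δ (B q i) (B q p))) ⟩
      sum (λ k → 1ᴹ p k * (Δ * (B q i * B r k)) + 1ᴹ i k * (Δ * (B r k * B q p)))
        ≈⟨ ∑-distrib-+ (λ k → 1ᴹ p k * (Δ * (B q i * B r k))) (λ k → 1ᴹ i k * (Δ * (B r k * B q p))) ⟩
      _ ≈⟨ +-cong (∑-delta p λ k → Δ * (B q i * B r k)) (∑-delta i λ k → Δ * (B r k * B q p)) ⟩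
      Δ * (B q i * B r p) + Δ * (B r i * B q p) ∎
      where
      M = A [ i ]≔ 1ᴹ q
      -- For `k = p` the matrix is `M` itself. For `k = i` exchanging rows `i` and `p` gives
      -- `A [ p ]≔ 1ᴹ q`. `cramer` evaluates both, and any other `k` repeats a row of `A`.
      replaced : ∀ k → permanent (M [ p ]≔ A k) ≈ 1ᴹ p k * (Δ * B q i) + 1ᴹ i k * (Δ * B q p)
      replaced k with p ≟ k | i ≟ k
      ... | yes ≡.refl | yes i≡k = contradiction i≡k i≢p
      ... | yes ≡.refl | no _ = trans
        (permanent-cong λ l j → trans
          ([]≔-cong M p (λ j → sym ([]≔-minimal A (i≢p ∘ ≡.sym) j)) l j)
          ([]≔-self M p l j))
        (trans (cramer i q) (sym (trans (+-cong (*-identityˡ _) (zeroˡ _)) (+-identityʳ _))))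
      ... | no _ | yes ≡.refl = trans
        (permanent-swap i≢p {A [ p ]≔ 1ᴹ q} {M [ p ]≔ A i}
          (λ j → trans ([]≔-minimal M i≢p j) (trans ([]≔-updated A i j) (sym ([]≔-updated A p j))))
          (λ j → trans ([]≔-updated M p j) (sym ([]≔-minimal A i≢p j)))
          (λ l l≢i l≢p j → trans ([]≔-minimal M l≢p j)
            (trans ([]≔-minimal A l≢i j) (sym ([]≔-minimal A l≢p j)))))
        (trans (cramer p q) (sym (trans (+-cong (zeroˡ _) (*-identityˡ _)) (+-identityˡ _))))
      ... | no p≢k | no i≢k = trans
        (permanent-equal-rows (M [ p ]≔ A k) p≢k λ j → trans ([]≔-updated M p j)
          (sym (trans ([]≔-minimal M (p≢k ∘ ≡.sym) j) ([]≔-minimal A (i≢k ∘ ≡.sym) j))))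
        (sym (trans (+-cong (zeroˡ _) (zeroˡ _)) (+-identityˡ _)))

    -- Odd sums with a replaced row, and the gradient.

    module _ (AB≈1 : A *ᴹ B ≈ᴹ 1ᴹ) where

      C : Matrix Carrier n
      C p j = A p j ^ 2 * B j p

      paritySum-repeated-row : ∀ {i p} → i ≢ p →
        paritySum 1ℙ (A [ i ]≔ A p) ≈ Δ * (C *ᴹ B) p i
      paritySum-repeated-row {i} {p} i≢p = begin
        paritySum 1ℙ (A [ i ]≔ v)
          ≈⟨ paritySum-expand 1ℙ A i v ⟩
        sum (λ q → v q * paritySum 1ℙ (A [ i ]≔ 1ᴹ q))
          ≈⟨ sum-cong-≋ (λ q → *-congˡ (expand-p q)) ⟩
        sum (λ q → v q * sum λ r → v r * f q r)
          ≈⟨ sum-cong-≋ (λ q → trans (*-distribˡ-sum (v q) λ r → v r * f q r)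
               (sym (+-identityʳ _))) ⟩
        -- The added zero makes room for `∑g`, which vanishes and turns the summand into a symmetric
        -- one.
        sum (λ q → sum (λ r → v q * (v r * f q r)) + 0#)
          ≈⟨ ∑-distrib-+ (λ q → sum λ r → v q * (v r * f q r)) (λ _ → 0#) ⟩
        ∑f + sum {n} (λ _ → 0#)
          ≈⟨ +-congˡ (trans (sum-≈ε +-commutativeMonoid {n} λ _ → refl) (sym ∑g≈0)) ⟩
        ∑f + ∑g
          ≈⟨ ∑-distrib-+ (λ q → sum λ r → v q * (v r * f q r)) (λ q → sum λ r → v q * (v r * g q r)) ⟨
        sum (λ q → sum (λ r → v q * (v r * f q r)) + sum (λ r → v q * (v r * g q r)))
          ≈⟨ sum-cong-≋ (λ q → ∑-distrib-+ (λ r → v q * (v r * f q r)) (λ r → v q * (v r * g q r))) ⟨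
        sum (λ q → sum λ r → v q * (v r * f q r) + v q * (v r * g q r))
          ≈⟨ ∑-symmetric (λ q r → v q * (v r * f q r) + v q * (v r * g q r)) symmetric ⟩
        sum (λ q → v q * (v q * f q q) + v q * (v q * g q q))
          ≈⟨ sum-cong-≋ diagonal ⟩
        sum (λ q → Δ * (C p q * B q i))
          ≈⟨ *-distribˡ-sum Δ (λ q → C p q * B q i) ⟨
        Δ * (C *ᴹ B) p i ∎
        where
        v = A p
        W : Fin n → Fin n → Matrix Carrier n
        W q r = A [ i ]≔ 1ᴹ q [ p ]≔ 1ᴹ r
        f g : Fin n → Fin n → Carrier
        f q r = paritySum 1ℙ (W q r)
        g q r = Δ * (B q i * B r p)
        ∑f = sum λ q → sum λ r → v q * (v r * f q r)
        ∑g = sum λ q → sum λ r → v q * (v r * g q r)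

        -- Row `p` still equals `v` after row `i` has been replaced.
        expand-p : ∀ q → paritySum 1ℙ (A [ i ]≔ 1ᴹ q) ≈ sum λ r → v r * f q r
        expand-p q = trans
          (paritySum-cong 1ℙ λ k j → sym (trans
            ([]≔-cong M p (λ j → sym ([]≔-minimal A (i≢p ∘ ≡.sym) j)) k j)
            ([]≔-self M p k j)))
          (paritySum-expand 1ℙ M p v)
          where M = A [ i ]≔ 1ᴹ q

        -- The double sum factors, and one factor is an off-diagonal entry of `A *ᴹ B`.
        ∑g≈0 : ∑g ≈ 0#
        ∑g≈0 = begin
          ∑g
            ≈⟨ sum-cong-≋ (λ q → trans
                 (sum-cong-≋ λ r → solve 5 (λ x y d s t → x :* (y :* (d :* (s :* t))) := x :* s :* (d :* (y :* t)))
                                     refl (v q) (v r) Δ (B q i) (B r p))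
                 (sym (*-distribˡ-sum (v q * B q i) (λ r → Δ * (v r * B r p))))) ⟩
          sum (λ q → v q * B q i * s)
            ≈⟨ *-distribʳ-sum s (λ q → v q * B q i) ⟨
          (A *ᴹ B) p i * s
            ≈⟨ *-congʳ (trans (AB≈1 p i) (1ᴹ-off (i≢p ∘ ≡.sym))) ⟩
          0# * s
            ≈⟨ zeroˡ s ⟩
          0# ∎
          where s = sum λ r → Δ * (v r * B r p)

        -- Exchanging rows `i` and `p` turns `W q r` into `W r q`, so `f r q` is the even sum of
        -- `W q r` and completes the permanent in `jacobi`.
        f+f : ∀ q r → f q r + f r q ≈ g q r + g r q
        f+f q r = begin
          f q r + f r q
            ≈⟨ +-congˡ (paritySum-swap i p i≢p 1ℙ {W q r} {W r q}
                 (λ j → trans ([]≔-minimal (A [ i ]≔ 1ᴹ r) i≢p j)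
                   (trans ([]≔-updated A i j) (sym ([]≔-updated (A [ i ]≔ 1ᴹ q) p j))))
                 (λ j → trans ([]≔-updated (A [ i ]≔ 1ᴹ r) p j)
                   (sym (trans ([]≔-minimal (A [ i ]≔ 1ᴹ q) i≢p j) ([]≔-updated A i j))))
                 (λ k k≢i k≢p j → trans
                   (trans ([]≔-minimal (A [ i ]≔ 1ᴹ r) k≢p j) ([]≔-minimal A k≢i j))
                   (sym (trans ([]≔-minimal (A [ i ]≔ 1ᴹ q) k≢p j) ([]≔-minimal A k≢i j))))) ⟩
          f q r + paritySum 0ℙ (W q r)
            ≈⟨ +-comm _ _ ⟩
          permanent (W q r)
            ≈⟨ jacobi i≢p q r ⟩
          g q r + g r q ∎

        -- This is `f+f` with terms moved across, which in characteristic two means adding them to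
        -- both sides.
        f+g : ∀ q r → f q r + g q r ≈ f r q + g r q
        f+g q r = begin
          f q r + g q r
            ≈⟨ x+[x+y]≈y (f r q) (f q r + g q r) ⟨
          f r q + (f r q + (f q r + g q r))
            ≈⟨ solve 3 (λ x y z → x :+ (x :+ (y :+ z)) := x :+ ((y :+ x) :+ z)) refl (f r q) (f q r) (g q r) ⟩
          f r q + ((f q r + f r q) + g q r)
            ≈⟨ +-congˡ (+-congʳ (f+f q r)) ⟩
          f r q + ((g q r + g r q) + g q r)
            ≈⟨ +-congˡ (solve 2 (λ x y → (x :+ y) :+ x := x :+ (x :+ y)) refl (g q r) (g r q)) ⟩
          f r q + (g q r + (g q r + g r q))
            ≈⟨ +-congˡ (x+[x+y]≈y (g q r) (g r q)) ⟩
          f r q + g r q ∎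

        symmetric : ∀ q r → v q * (v r * f q r) + v q * (v r * g q r) ≈
                            v r * (v q * f r q) + v r * (v q * g r q)
        symmetric q r = begin
          v q * (v r * f q r) + v q * (v r * g q r)
            ≈⟨ factor (v q) (v r) (f q r) (g q r) ⟩
          v q * v r * (f q r + g q r)
            ≈⟨ *-cong (*-comm (v q) (v r)) (f+g q r) ⟩
          v r * v q * (f r q + g r q)
            ≈⟨ factor (v r) (v q) (f r q) (g r q) ⟨
          v r * (v q * f r q) + v r * (v q * g r q) ∎
          where
          factor : ∀ x y s t → x * (y * s) + x * (y * t) ≈ x * y * (s + t)
          factor = solve 4 (λ x y s t → x :* (y :* s) :+ x :* (y :* t) := x :* y :* (s :+ t)) refl

        diagonal : ∀ q → v q * (v q * f q q) + v q * (v q * g q q) ≈ Δ * (C p q * B q i)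
        diagonal q = trans
          (+-congʳ (*-congˡ (*-congˡ (paritySum-same-column 1ℙ A q i≢p))))
          -- `con 1` appears because `A p q ^ 2` unfolds to `A p q * (A p q * 1#)`.
          (solve 4 (λ x d s t → x :* (x :* con 0) :+ x :* (x :* (d :* (s :* t))) :=
                                d :* (x :* (x :* con 1) :* t :* s))
             refl (v q) Δ (B q i) (B q p))

      -- Squaring is additive, so the diagonal entries are those of AB squared.
      CB-diagonal : ∀ i → (C *ᴹ B) i i ≈ 1#
      CB-diagonal i = begin
        sum (λ q → C i q * B q i)
          ≈⟨ sum-cong-≋ (λ q → solve 2 (λ x b → x :* (x :* con 1) :* b :* b := (x :* b) :* (x :* b))
                                 refl (A i q) (B q i)) ⟩
        sum (λ q → x q * x q)
          ≈⟨ ∑-symmetric (λ q r → x q * x r) (λ q r → *-comm (x q) (x r)) ⟨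
        sum (λ q → sum λ r → x q * x r)
          ≈⟨ sum-cong-≋ (λ q → *-distribˡ-sum (x q) x) ⟨
        sum (λ q → x q * sum x)
          ≈⟨ *-distribʳ-sum (sum x) x ⟨
        sum x * sum x
          ≈⟨ *-cong (trans (AB≈1 i i) (1ᴹ-diagonal i)) (trans (AB≈1 i i) (1ᴹ-diagonal i)) ⟩
        1# * 1#
          ≈⟨ *-identityˡ 1# ⟩
        1# ∎
        where
        x : Vector Carrier n
        x q = A i q * B q i

      F = paritySum 1ℙ A

      -- On the diagonal `CB-diagonal` makes the first summand equal to `Δ`; the `Δ` in `F + Δ`
      -- cancels it and leaves `F`.
      paritySum-row : ∀ i p →
        paritySum 1ℙ (A [ i ]≔ A p) ≈ Δ * (C *ᴹ B) p i + 1ᴹ i p * (F + Δ)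
      paritySum-row i p with i ≟ p
      ... | no  i≢p = trans (paritySum-repeated-row i≢p)
              (sym (trans (+-congˡ (zeroˡ (F + Δ))) (+-identityʳ _)))
      ... | yes ≡.refl = begin
        paritySum 1ℙ (A [ i ]≔ A i)
          ≈⟨ paritySum-cong 1ℙ ([]≔-self A i) ⟩
        F
          ≈⟨ x+[x+y]≈y Δ F ⟨
        Δ + (Δ + F)
          ≈⟨ +-cong (*-identityʳ Δ) (trans (*-identityˡ _) (+-comm F Δ)) ⟨
        Δ * 1# + 1# * (F + Δ)
          ≈⟨ +-congʳ (*-congˡ (CB-diagonal i)) ⟨
        Δ * (C *ᴹ B) i i + 1# * (F + Δ) ∎

      gradient : 𝒢 A ≈ᴹ Δ ·ᴹ (B *ᴹ C *ᴹ B) +ᴹ (F + Δ) ·ᴹ B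
      gradient j i = begin
        𝒢 A j i
          ≈⟨ trans (𝒢≈Φ A i j) (Φ≈paritySum (A [ i ]≔ 1ᴹ j)) ⟩
        paritySum 1ℙ (A [ i ]≔ 1ᴹ j)
          -- Once the unit row is a combination of rows of `A`, linearity leaves only the cases of
          -- `paritySum-row`.
          ≈⟨ paritySum-cong 1ℙ ([]≔-cong A i λ k → sym (BA≈1 j k)) ⟩
        paritySum 1ℙ (A [ i ]≔ λ k → sum λ p → B j p * A p k)
          ≈⟨ paritySum-linear 1ℙ A i (B j) A ⟩
        sum (λ p → B j p * paritySum 1ℙ (A [ i ]≔ A p))
          ≈⟨ sum-cong-≋ (λ p → trans (*-congˡ (paritySum-row i p))
               (solve 5 (λ b d x e s → b :* (d :* x :+ e :* s) := d :* (b :* x) :+ e :* (s :* b))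
                  refl (B j p) Δ ((C *ᴹ B) p i) (1ᴹ i p) (F + Δ))) ⟩
        sum (λ p → Δ * (B j p * (C *ᴹ B) p i) + 1ᴹ i p * ((F + Δ) * B j p))
          ≈⟨ ∑-distrib-+ (λ p → Δ * (B j p * (C *ᴹ B) p i)) (λ p → 1ᴹ i p * ((F + Δ) * B j p)) ⟩
        _ ≈⟨ +-cong (sym (*-distribˡ-sum Δ λ p → B j p * (C *ᴹ B) p i)) (∑-delta i λ p → (F + Δ) * B j p) ⟩
        Δ * (B *ᴹ (C *ᴹ B)) j i + (F + Δ) * B j i
          ≈⟨ +-congʳ (*-congˡ (*ᴹ-assoc B C B j i)) ⟨
        Δ * (B *ᴹ C *ᴹ B) j i + (F + Δ) * B j i ∎

-- Results and costs of composite computations.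

module ExecutionProperties (R : RawRing a ℓ) {n : ℕ} where

  open RawRing R using (Carrier)
  open Execution R {n}

  result->>= : {X Y : Set a} (c : Computation Carrier n X) (f : X → Computation Carrier n Y) →
               result (c >>= f) ≡ result (f (result c))
  result->>= (return x)       f = ≡.refl
  result->>= (arith op x y k) f = result->>= (k (applyOp op x y)) f
  result->>= (matmul A B k)   f = result->>= (k _) f

  arithmeticOps->>= : {X Y : Set a} (c : Computation Carrier n X) (f : X → Computation Carrier n Y) →
    arithmeticOps (c >>= f) ≡ arithmeticOps c ℕ.+ arithmeticOps (f (result c))
  arithmeticOps->>= (return x)       f = ≡.refl
  arithmeticOps->>= (arith op x y k) f = ≡.cong suc (arithmeticOps->>= (k (applyOp op x y)) f)
  arithmeticOps->>= (matmul A B k)   f = arithmeticOps->>= (k _) f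

  matrixMultiplications->>= : {X Y : Set a} (c : Computation Carrier n X) (f : X → Computation Carrier n Y) →
    matrixMultiplications (c >>= f) ≡ matrixMultiplications c ℕ.+ matrixMultiplications (f (result c))
  matrixMultiplications->>= (return x)       f = ≡.refl
  matrixMultiplications->>= (arith op x y k) f = matrixMultiplications->>= (k (applyOp op x y)) f
  matrixMultiplications->>= (matmul A B k)   f = ≡.cong suc (matrixMultiplications->>= (k _) f)

  result-sequence : {X : Set a} (cs : Vector (Computation Carrier n X) m) →
                    ∀ i → result (sequence cs) i ≡ result (cs i)
  result-sequence {m = suc m} cs i
    rewrite result->>= (cs zero) (λ x → sequence (cs ∘ suc) >>= λ xs → return (x ∷ᵛ xs))
          | result->>= (sequence (cs ∘ suc)) (λ xs → return (result (cs zero) ∷ᵛ xs))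
    with i
  ... | zero  = ≡.refl
  ... | suc i = result-sequence (cs ∘ suc) i

  arithmeticOps-sequence : {X : Set a} (cs : Vector (Computation Carrier n X) m) {k : ℕ} →
    (∀ i → arithmeticOps (cs i) ≡ k) → arithmeticOps (sequence cs) ≡ m ℕ.* k
  arithmeticOps-sequence {m = zero}  cs ops≡k = ≡.refl
  arithmeticOps-sequence {m = suc m} cs ops≡k
    rewrite arithmeticOps->>= (cs zero) (λ x → sequence (cs ∘ suc) >>= λ xs → return (x ∷ᵛ xs))
          | arithmeticOps->>= (sequence (cs ∘ suc)) (λ xs → return (result (cs zero) ∷ᵛ xs))
          | ℕ.+-identityʳ (arithmeticOps (sequence (cs ∘ suc)))
    = ≡.cong₂ ℕ._+_ (ops≡k zero) (arithmeticOps-sequence (cs ∘ suc) (ops≡k ∘ suc))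

  matrixMultiplications-sequence : {X : Set a} (cs : Vector (Computation Carrier n X) m) →
    (∀ i → matrixMultiplications (cs i) ≡ 0) → matrixMultiplications (sequence cs) ≡ 0
  matrixMultiplications-sequence {m = zero}  cs mults≡0 = ≡.refl
  matrixMultiplications-sequence {m = suc m} cs mults≡0
    rewrite matrixMultiplications->>= (cs zero) (λ x → sequence (cs ∘ suc) >>= λ xs → return (x ∷ᵛ xs))
          | matrixMultiplications->>= (sequence (cs ∘ suc)) (λ xs → return (result (cs zero) ∷ᵛ xs))
          | ℕ.+-identityʳ (matrixMultiplications (sequence (cs ∘ suc)))
    = ≡.cong₂ ℕ._+_ (mults≡0 zero) (matrixMultiplications-sequence (cs ∘ suc) (mults≡0 ∘ suc))

  module _ (f : Fin n → Fin n → Computation Carrier n Carrier) where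

    result-forEntries : ∀ i j → result (forEntries f) i j ≡ result (f i j)
    result-forEntries i j = ≡.trans
      (≡.cong-app (result-sequence (λ i → sequence (f i)) i) j)
      (result-sequence (f i) j)

    arithmeticOps-forEntries : ∀ {k} → (∀ i j → arithmeticOps (f i j) ≡ k) →
      arithmeticOps (forEntries f) ≡ n ℕ.* (n ℕ.* k)
    arithmeticOps-forEntries ops≡k = arithmeticOps-sequence (λ i → sequence (f i))
      λ i → arithmeticOps-sequence (f i) (ops≡k i)

    matrixMultiplications-forEntries : (∀ i j → matrixMultiplications (f i j) ≡ 0) →
      matrixMultiplications (forEntries f) ≡ 0
    matrixMultiplications-forEntries mults≡0 = matrixMultiplications-sequence (λ i → sequence (f i))
      λ i → matrixMultiplications-sequence (f i) (mults≡0 i)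

-- Result and cost of the gradient algorithm.

module GradientAlgorithm (R : CommutativeRing a ℓ) {n : ℕ} where

  open CommutativeRing R hiding (zero)
  open RingMatrices R
  open Execution rawRing {n}
  open ExecutionProperties rawRing {n}

  module _ (A B : Matrix Carrier n) (F Δ : Carrier) where

    private
      C-entry : Fin n → Fin n → Computation Carrier n Carrier
      C-entry p j = A p j ⊠ A p j >>= λ s → s ⊠ B j p

      output-entry : Matrix Carrier n → Fin n → Fin n → Computation Carrier n Carrier
      output-entry BCB i j =
        Δ ⊠ BCB i j >>= λ x → (F + Δ) ⊠ B i j >>= λ y → x ⊞ y

      -- The continuation of `gradientAlgorithm` once `C` is built, named so that the lemmas on
      -- `>>=` can be applied to it. Its steps before the final `forEntries` are then executed by
      -- computation.
      rest : Matrix Carrier n → Computation Carrier n (Matrix Carrier n)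
      rest C =
        B ⊠ᴹ C >>= λ BC → BC ⊠ᴹ B >>= λ BCB → F ⊞ Δ >>= λ F+Δ →
        forEntries λ i j → Δ ⊠ BCB i j >>= λ x → F+Δ ⊠ B i j >>= λ y → x ⊞ y

      C′ : Matrix Carrier n
      C′ = result (forEntries C-entry)

    result-gradientAlgorithm :
      result (gradientAlgorithm A B F Δ) ≈ᴹ
      Δ ·ᴹ (B *ᴹ (λ p j → A p j ^ 2 * B j p) *ᴹ B) +ᴹ (F + Δ) ·ᴹ B
    result-gradientAlgorithm i j = trans
      (reflexive (≡.trans
        (≡.cong (λ M → M i j) (result->>= (forEntries C-entry) rest))
        (result-forEntries (output-entry (B *ᴹ C′ *ᴹ B)) i j)))
      (+-congʳ (*-congˡ (*ᴹ-cong {B′ = B} (*ᴹ-cong {A = B} (λ _ _ → refl) C′≈C) (λ _ _ → refl) i j)))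
      where
      open ParityExpansion R using (*ᴹ-cong)
      C′≈C : C′ ≈ᴹ λ p j → A p j ^ 2 * B j p
      C′≈C p j = trans (reflexive (result-forEntries C-entry p j))
        (*-congʳ (*-congˡ (sym (*-identityʳ (A p j)))))

    matrixMultiplications-gradientAlgorithm :
      matrixMultiplications (gradientAlgorithm A B F Δ) ≡ 2
    matrixMultiplications-gradientAlgorithm = ≡.trans
      (matrixMultiplications->>= (forEntries C-entry) rest)
      -- The two successors count `B ⊠ᴹ C` and `BC ⊠ᴹ B`.
      (≡.cong₂ (λ x y → x ℕ.+ suc (suc y))
        (matrixMultiplications-forEntries C-entry λ _ _ → ≡.refl)
        (matrixMultiplications-forEntries (output-entry (B *ᴹ C′ *ᴹ B)) λ _ _ → ≡.refl))

    -- Two multiplications for each entry of `C`, three operations for each output entry, and the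
    -- single addition `F ⊞ Δ`.
    arithmeticOps-gradientAlgorithm :
      arithmeticOps (gradientAlgorithm A B F Δ) ≡ n ℕ.* (n ℕ.* 2) ℕ.+ suc (n ℕ.* (n ℕ.* 3))
    arithmeticOps-gradientAlgorithm = ≡.trans
      (arithmeticOps->>= (forEntries C-entry) rest)
      (≡.cong₂ (λ x y → x ℕ.+ suc y)
        (arithmeticOps-forEntries C-entry λ _ _ → ≡.refl)
        (arithmeticOps-forEntries (output-entry (B *ᴹ C′ *ᴹ B)) λ _ _ → ≡.refl))

-- The count is five times the square of `n`, plus one, and the extra one is at most another square.
quadratic-bound : ∀ n → 1 ≤ n → n ℕ.* (n ℕ.* 2) ℕ.+ suc (n ℕ.* (n ℕ.* 3)) ≤ 6 ℕ.* n ℕ.^ 2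
quadratic-bound n 1≤n = begin
  n ℕ.* (n ℕ.* 2) ℕ.+ suc (n ℕ.* (n ℕ.* 3))
    ≡⟨ solve 1 (λ x → x :* (x :* con 2) :+ (con 1 :+ x :* (x :* con 3)) :=
                       con 1 :+ con 5 :* (x :* x)) ≡.refl n ⟩
  1 ℕ.+ 5 ℕ.* (n ℕ.* n)
    ≤⟨ ℕ.+-monoˡ-≤ (5 ℕ.* (n ℕ.* n)) (ℕ.*-mono-≤ 1≤n 1≤n) ⟩
  n ℕ.* n ℕ.+ 5 ℕ.* (n ℕ.* n)
    ≡⟨ solve 1 (λ x → x :* x :+ con 5 :* (x :* x) := con 6 :* (x :* (x :* con 1))) ≡.refl n ⟩
  6 ℕ.* n ℕ.^ 2 ∎
  where
  open ℕ.≤-Reasoning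
  open +-*-Solver

-- The formula for the gradient and its cost.

𝒢-formula : (R : CommutativeRing a ℓ) →
  let open CommutativeRing R
      open RingMatrices R
  in HasCharacteristic 2 →
     ∀ {n} (A : Matrix Carrier n) (A-invertible : Invertibleᴹ A) →
     let B = proj₁ A-invertible
         Δ = det A
         F = Φ A
         C = λ p j → A p j ^ 2 * B j p
     in 𝒢 A ≈ᴹ Δ ·ᴹ (B *ᴹ C *ᴹ B) +ᴹ (F + Δ) ·ᴹ B
𝒢-formula R char2 A (B , BA≈1 , AB≈1) i j = trans
  (gradient A B BA≈1 AB≈1 i j)
  -- The `permanent` and `paritySum 1ℙ` of `gradient` are translated back to `det` and `Φ`.
  (sym (+-cong (*-congʳ (det≈permanent A))
               (*-congʳ (+-cong (Φ≈paritySum A) (det≈permanent A)))))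
  where
  open CommutativeRing R
  open ParityExpansion R using (Φ≈paritySum)
  open CharacteristicTwo R char2

proposition5p2 : ∀ {a ℓ} →
  (∀ (R : CommutativeRing a ℓ) →
   let open CommutativeRing R
       open RingMatrices R
   in HasCharacteristic 2 →
      ∀ {n} (A : Matrix Carrier n) (A-invertible : Invertibleᴹ A) →
      let B = proj₁ A-invertible
          Δ = det A
          F = Φ A
          C = λ p j → A p j ^ 2 * B j p
      in 𝒢 A ≈ᴹ Δ ·ᴹ (B *ᴹ C *ᴹ B) +ᴹ (F + Δ) ·ᴹ B)
  ×
  (∃[ c ] ∃[ n₀ ]
   ∀ (R : CommutativeRing a ℓ) →
   let open CommutativeRing R
       open RingMatrices R
       open Execution rawRing
   in HasCharacteristic 2 →
      ∀ {n} (A : Matrix Carrier n) (A-invertible : Invertibleᴹ A) →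
      let computation = gradientAlgorithm A (proj₁ A-invertible) (Φ A) (det A)
      in result computation ≈ᴹ 𝒢 A
         × matrixMultiplications computation ≡ 2
         × (n₀ ≤ n → arithmeticOps computation ≤ c ℕ.* n ℕ.^ 2))
-- The bound starts at order one because at order zero the addition `F ⊞ Δ` still costs one
-- operation.
proposition5p2 = 𝒢-formula , 6 , 1 , λ R char2 {n} A A-invertible →
  let open CommutativeRing R
      open RingMatrices R
      open GradientAlgorithm R
      B = proj₁ A-invertible
  in (λ i j → trans (result-gradientAlgorithm A B (Φ A) (det A) i j)
                    (sym (𝒢-formula R char2 A A-invertible i j)))
   , matrixMultiplications-gradientAlgorithm A B (Φ A) (det A)
   , λ 1≤n → ℕ.≤-trans (ℕ.≤-reflexive (arithmeticOps-gradientAlgorithm A B (Φ A) (det A)))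
                       (quadratic-bound n 1≤n)
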